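{- Let $F=\langle f_1,\ldots,f_k\rangle$ be a normalized solution to an instance $(\mathcal{T}_{initial},\mathcal{T}_{final},k)$ of Flip Distance, let $C$ be a component of $\mathcal{D}_F$, and assume the flips of $C$ form a prefix $\langle f_1,\ldots,f_t\rangle$ of $F$. Then there is a flip $f_h\in C$ such that $\epsilon(f_h)$ is a changed edge, and a sequence of at most $2|V(C)|$ actions which, started at the edge $\epsilon(f_h)$ of the current triangulation $\mathcal{T}_{initial}$ with an empty stack, performs exactly the flips of $C$, in an order that is a topological sorting of $C$.
   Context: A triangulation of a finite point set $\mathcal{P}$ in the plane is a partition of the convex hull of $\mathcal{P}$ into triangles whose vertex set is $\mathcal{P}$. For an interior edge $e$ of a triangulation $\mathcal{T}$, the quadrilateral associated with $e$ is the union of the two triangles of $\mathcal{T}$ sharing $e$. A flip of $e$ is admissible in $\mathcal{T}$ if $e\in\mathcal{T}$ and its associated quadrilateral $Q$ is convex; performing it replaces $e$ by the other diagonal of $Q$. For a flip $f$, $\epsilon(f)$ is the edge removed and $\phi(f)$ the edge created. Two distinct edges share a triangle in $\mathcal{T}$ if they are edges of a common triangle of $\mathcal{T}$. A sequence $F=\langle f_1,\ldots,f_r\rangle$ is valid with respect to $\mathcal{T}$ if there are triangulations $\mathcal{T}_0=\mathcal{T},\ldots,\mathcal{T}_r$ with $f_i$ admissible in $\mathcal{T}_{i-1}$ and yielding $\mathcal{T}_i$. The flip distance between two triangulations is the minimum length of a valid sequence transforming one into the other. For an instance $(\mathcal{T}_{initial},\mathcal{T}_{final},k)$ of Flip Distance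 (is the flip distance equal to $k$?), a solution is a valid sequence of $k$ flips transforming $\mathcal{T}_{initial}$ into $\mathcal{T}_{final}$ with $k$ the flip distance; a changed edge is an edge of $\mathcal{T}_{initial}$ not in $\mathcal{T}_{final}$. For $i<j$, $f_i\to f_j$ if (1) $\phi(f_i)=\epsilon(f_j)$ or $\phi(f_i)$ and $\epsilon(f_j)$ share a triangle in $\mathcal{T}_{j-1}$, and (2) no $p$ with $i<p<j$ has $\epsilon(f_p)=\phi(f_i)$. $\mathcal{D}_F$ is the DAG on the flips of $F$ with these arcs; components are weakly connected components. A component is essential if it contains a flip whose underlying edge is a changed edge. A normalized solution is a solution $F$ such that every component of $\mathcal{D}_F$ is essential and the flips of each component form a consecutive block of $F$. Actions: an agent with a stack is located at an edge $e$ of a current triangulation $\mathcal{T}_{current}$ (initially $\mathcal{T}_{initial}$); each action is one of: (i) move to one of the (at most 4) edges sharing a triangle with $e$ in $\mathcal{T}_{current}$; (ii) flip $e$ and move to one of the 4 edges that shared a triangle with $e$ in $\mathcal{T}_{current}$ before the flip; (iii) flip $e$, push the newly created edge onto the stack, and move to one of the 4 edges that shared a triangle with $e$ before the flip; (iv) flip $e$ and jump to the edge on top of the stack; (v) flip $e$, jump to the edge on top of the stack, and pop the stack. Each flip updates $\mathcal{T}_{current}$. -}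

module Defs where

open import Level using (0ℓ)
open import Data.Nat as ℕ using (ℕ; zero; suc)
open import Data.Fin as Fin using (Fin; toℕ; inject₁; fromℕ)
open import Data.Product using (Σ; ∃; ∃-syntax; _×_; _,_; proj₁; proj₂)
open import Data.Sum using (_⊎_)
open import Data.Empty using (⊥)
open import Data.List using (List; []; _∷_; _++_)
open import Data.List.Membership.Propositional using (_∈_)
open import Relation.Nullary using (¬_)
open import Relation.Binary.PropositionalEquality using (_≡_; _≢_)
open import Relation.Binary.Structures using (IsStrictTotalOrder)
open import Algebra.Structures using (IsCommutativeRing)
open import Function.Bundles using (_⇔_)
open import Function.Definitions using (Injective)

-- Ordered fields (the plane is K × K for an ordered field K; ℝ is one).

record OrderedField : Set₁ where
  infixl 6 _+_
  infixl 7 _*_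
  infix 4 _<_
  field
    Carrier : Set
    _+_ _*_ : Carrier → Carrier → Carrier
    -_      : Carrier → Carrier
    0# 1#   : Carrier
    _<_     : Carrier → Carrier → Set
    isCommutativeRing : IsCommutativeRing _≡_ _+_ _*_ -_ 0# 1#
    0≢1     : 0# ≢ 1#
    inverse : ∀ x → x ≢ 0# → ∃[ y ] (x * y ≡ 1#)
    isStrictTotalOrder : IsStrictTotalOrder _≡_ _<_
    +-mono-< : ∀ {x y} z → x < y → x + z < y + z
    *-pos    : ∀ {x y} → 0# < x → 0# < y → 0# < x * y

  _-_ : Carrier → Carrier → Carrier
  x - y = x + (- y)

  _≤_ : Carrier → Carrier → Set
  x ≤ y = (x < y) ⊎ (x ≡ y)

module Geometry (K : OrderedField) where
  open OrderedField K

  Point : Set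
  Point = Carrier × Carrier

  -- twice the signed area of the triangle (a, b, c)
  orient : Point → Point → Point → Carrier
  orient (ax , ay) (bx , by) (cx , cy) =
    ((bx - ax) * (cy - ay)) - ((by - ay) * (cx - ax))

  sumFin : (m : ℕ) → (Fin m → Carrier) → Carrier
  sumFin zero    f = 0#
  sumFin (suc m) f = f Fin.zero + sumFin m (λ i → f (Fin.suc i))

  module PointSet (n : ℕ) (pt : Fin n → Point) where

    record Edge : Set where
      constructor edge
      field
        a b : Fin n
        .lt : a Fin.< b
    open Edge public

    record Triangle : Set where
      constructor triangle
      field
        v1 v2 v3 : Fin n
        .lt12 : v1 Fin.< v2
        .lt23 : v2 Fin.< v3
    open Triangle public

    VertexOf : Fin n → Triangle → Set
    VertexOf i t = (i ≡ v1 t) ⊎ (i ≡ v2 t) ⊎ (i ≡ v3 t)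

    EdgeOf : Edge → Triangle → Set
    EdgeOf e t = VertexOf (a e) t × VertexOf (b e) t

    HasVertices : Triangle → Fin n → Fin n → Fin n → Set
    HasVertices t x y z = ∀ i → VertexOf i t ⇔ ((i ≡ x) ⊎ (i ≡ y) ⊎ (i ≡ z))

    InClosed : Point → Triangle → Set
    InClosed q t =
      let A = pt (v1 t) ; B = pt (v2 t) ; C = pt (v3 t) in
      (0# ≤ orient A B q × 0# ≤ orient B C q × 0# ≤ orient C A q)
      ⊎ (orient A B q ≤ 0# × orient B C q ≤ 0# × orient C A q ≤ 0#)

    InInterior : Point → Triangle → Set
    InInterior q t =
      let A = pt (v1 t) ; B = pt (v2 t) ; C = pt (v3 t) in
      (0# < orient A B q × 0# < orient B C q × 0# < orient C A q)
      ⊎ (orient A B q < 0# × orient B C q < 0# × orient C A q < 0#)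

    InConvexHull : Point → Set
    InConvexHull q = Σ (Fin n → Carrier) λ λs →
      (∀ i → 0# ≤ λs i) × sumFin n λs ≡ 1# ×
      sumFin n (λ i → λs i * proj₁ (pt i)) ≡ proj₁ q ×
      sumFin n (λ i → λs i * proj₂ (pt i)) ≡ proj₂ q

    record IsTriangulation (T : List Triangle) : Set where
      field
        nondegenerate : ∀ {t} → t ∈ T → orient (pt (v1 t)) (pt (v2 t)) (pt (v3 t)) ≢ 0#
        interiorsDisjoint : ∀ {t u} → t ∈ T → u ∈ T → t ≢ u →
                            ∀ q → ¬ (InInterior q t × InInterior q u)
        coversHull : ∀ q → InConvexHull q ⇔ (∃[ t ] (t ∈ T × InClosed q t))
        allPointsUsed : ∀ i → ∃[ t ] (t ∈ T × VertexOf i t)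
        noPointOnTriangle : ∀ {t} → t ∈ T → ∀ i → InClosed (pt i) t → VertexOf i t

    SameTriangles : List Triangle → List Triangle → Set
    SameTriangles T U = ∀ t → (t ∈ T) ⇔ (t ∈ U)

    EdgeIn : List Triangle → Edge → Set
    EdgeIn T e = ∃[ t ] (t ∈ T × EdgeOf e t)

    ShareTri : List Triangle → Edge → Edge → Set
    ShareTri T e e' = e ≢ e' × ∃[ t ] (t ∈ T × EdgeOf e t × EdgeOf e' t)

    Flip : Set
    Flip = Edge × Edge

    ε : Flip → Edge
    ε = proj₁

    φ : Flip → Edge
    φ = proj₂

    ProperlyCross : Fin n → Fin n → Fin n → Fin n → Set
    ProperlyCross p q r s =
      orient (pt p) (pt q) (pt r) * orient (pt p) (pt q) (pt s) < 0# ×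
      orient (pt r) (pt s) (pt p) * orient (pt r) (pt s) (pt q) < 0#

    -- Step T f U : f is admissible in T and performing it yields U.
    -- The quadrilateral t₁ ∪ t₂ with diagonal ε f = ab and other
    -- vertices c, d is convex iff its diagonals ab and cd cross properly.
    Step : List Triangle → Flip → List Triangle → Set
    Step T (e , e') U =
      Σ Triangle λ t₁ → Σ Triangle λ t₂ → Σ (Fin n) λ c → Σ (Fin n) λ d →
        t₁ ∈ T × t₂ ∈ T × t₁ ≢ t₂ ×
        HasVertices t₁ (a e) (b e) c × HasVertices t₂ (a e) (b e) d ×
        (((a e' ≡ c) × (b e' ≡ d)) ⊎ ((a e' ≡ d) × (b e' ≡ c))) ×
        ProperlyCross (a e) (b e) c d ×
        (∀ t → (t ∈ U) ⇔ (((t ∈ T) × t ≢ t₁ × t ≢ t₂)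
                          ⊎ HasVertices t c d (a e)
                          ⊎ HasVertices t c d (b e)))

    Valid : (k : ℕ) → (Fin k → Flip) → (Fin (suc k) → List Triangle) → Set
    Valid k F Ts = ∀ i → Step (Ts (inject₁ i)) (F i) (Ts (Fin.suc i))

    Transforms : List Triangle → List Triangle → (k : ℕ) → (Fin k → Flip) →
                 (Fin (suc k) → List Triangle) → Set
    Transforms Tinit Tfin k F Ts =
      Ts Fin.zero ≡ Tinit × Valid k F Ts × SameTriangles (Ts (fromℕ k)) Tfin

    IsSolution : List Triangle → List Triangle → (k : ℕ) → (Fin k → Flip) →
                 (Fin (suc k) → List Triangle) → Set
    IsSolution Tinit Tfin k F Ts =
      Transforms Tinit Tfin k F Ts ×
      (∀ k' F' Ts' → Transforms Tinit Tfin k' F' Ts' → k ℕ.≤ k')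

    ChangedEdge : List Triangle → List Triangle → Edge → Set
    ChangedEdge Tinit Tfin e = EdgeIn Tinit e × ¬ EdgeIn Tfin e

    module DAG (k : ℕ) (F : Fin k → Flip) (Ts : Fin (suc k) → List Triangle) where

      -- the arc f_i → f_j of D_F (0-based indices; T_{j-1} is Ts (inject₁ j))
      Arc : Fin k → Fin k → Set
      Arc i j = i Fin.< j ×
                ((φ (F i) ≡ ε (F j)) ⊎ ShareTri (Ts (inject₁ j)) (φ (F i)) (ε (F j))) ×
                (∀ p → i Fin.< p → p Fin.< j → ε (F p) ≢ φ (F i))

      data Conn : Fin k → Fin k → Set where
        c-refl : ∀ {i} → Conn i i
        c-fwd  : ∀ {i j l} → Arc i j → Conn j l → Conn i l
        c-bwd  : ∀ {i j l} → Arc j i → Conn j l → Conn i l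

      -- the component of i is {j | Conn i j}
      Essential : List Triangle → List Triangle → Fin k → Set
      Essential Tinit Tfin i = ∃[ j ] (Conn i j × ChangedEdge Tinit Tfin (ε (F j)))

      ConsecutiveBlock : Fin k → Set
      ConsecutiveBlock i = ∀ p q r → p Fin.< q → q Fin.< r → Conn i p → Conn i r → Conn i q

    IsNormalizedSolution : List Triangle → List Triangle → (k : ℕ) → (Fin k → Flip) →
                           (Fin (suc k) → List Triangle) → Set
    IsNormalizedSolution Tinit Tfin k F Ts =
      IsSolution Tinit Tfin k F Ts ×
      (∀ i → Essential Tinit Tfin i × ConsecutiveBlock i)
      where open DAG k F Ts

    -- Runs of the agent: Run T e s m fs means that starting in current
    -- triangulation T at edge e with stack s, a sequence of m actions
    -- performs the flips fs (in this order).
    data Run : List Triangle → Edge → List Edge → ℕ → List Flip → Set where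
      stop     : ∀ {T e s} → Run T e s 0 []
      move     : ∀ {T e e' s m fs} → ShareTri T e e' → Run T e' s m fs →
                 Run T e s (suc m) fs
      flipMove : ∀ {T U e e' g s m fs} → Step T (e , g) U → ShareTri T e e' →
                 Run U e' s m fs → Run T e s (suc m) ((e , g) ∷ fs)
      flipPush : ∀ {T U e e' g s m fs} → Step T (e , g) U → ShareTri T e e' →
                 Run U e' (g ∷ s) m fs → Run T e s (suc m) ((e , g) ∷ fs)
      flipJump : ∀ {T U e g top s m fs} → Step T (e , g) U →
                 Run U top (top ∷ s) m fs → Run T e (top ∷ s) (suc m) ((e , g) ∷ fs)
      flipPop  : ∀ {T U e g top s m fs} → Step T (e , g) U →
                 Run U top s m fs → Run T e (top ∷ s) (suc m) ((e , g) ∷ fs)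

    OccursBefore : {A : Set} → A → A → List A → Set
    OccursBefore x y xs = ∃[ us ] ∃[ vs ] (xs ≡ us ++ (x ∷ vs) × y ∈ vs)

{-# OPTIONS --safe #-}
module Submission where

-- A flip consumes two triangles and creates two, so a valid sequence of flips is a run of a Petri
-- net whose tokens are triangles, and flips that share no triangle commute. An arc of D_F is a
-- chain of flips in which each consumes a triangle created by an earlier one. The geometry enters
-- only through two facts, both consequences of the triangles having disjoint interiors: an edge
-- lies in at most two triangles, and the edge created by a flip is not already present.
--
-- The agent stands at an edge ε f. If f cannot be flipped yet, an earlier flip p consumes a triangle
-- at ε f; the agent moves to ε p, deals with p recursively and comes back to ε f. Once f is flipped, the
-- remaining flips of its component fall into at most two components, since each of them has to
-- consume one of the two triangles just created. With two components the agent pushes φ f,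
-- tours the first one, pops φ f together with the last flip of that tour, and moves on to the second.
-- Every plain move is paid for by a flip, which gives 2|V(C)| actions.

open import Defs
open import Level using (0ℓ)
open import Data.Nat as ℕ using (ℕ; zero; suc; s≤s; z≤n)
open import Data.Integer as ℤ using (ℤ; -[1+_]; _⊖_)
import Data.Integer.Properties as ℤ
open import Data.Sign as Sign using (Sign)
open import Data.Maybe using (just; nothing)
open import Data.Product using (Σ; ∃-syntax; _×_; _,_; proj₁; proj₂)
open import Data.Sum as Sum using (_⊎_; inj₁; inj₂; swap; [_,_]′)
open import Data.Empty using (⊥; ⊥-elim)
open import Data.List using (List; []; _∷_; _++_; filter; length; map; tabulate; allFin)
open import Data.List.Relation.Unary.All as All using (All; []; _∷_)
open import Relation.Nullary using (¬_; yes; no; Dec)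
open import Relation.Binary using (tri<; tri≈; tri>; IsStrictTotalOrder; Tri; DecidableEquality)
open import Relation.Binary.PropositionalEquality hiding ([_])
open import Relation.Binary.Definitions using (WeaklyDecidable)
open import Algebra.Bundles using (CommutativeRing)
open import Algebra.Solver.Ring.AlmostCommutativeRing
import Algebra.Properties.Ring
import Algebra.Properties.AbelianGroup
import Algebra.Properties.Semiring.Mult
import Algebra.Solver.Ring
open import Data.Fin as Fin using (Fin)
import Data.Nat.Properties as ℕₚ
import Data.Fin.Properties as Fin
open import Data.List.Relation.Unary.Any using (here; there; Any; any?)
open import Data.List.Membership.Propositional.Properties using (∈-filter⁺; ∈-filter⁻; ∈-++⁺ˡ; ∈-++⁺ʳ; ∈-++⁻; ∈-∃++; ∈-allFin)
import Data.List.Relation.Unary.All.Properties as All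
open import Data.List.Membership.Propositional using (_∈_; _∉_; find; lose)
import Data.Empty.Irrelevant as Irr
open import Relation.Nullary.Decidable using (map′; _×-dec_; _⊎-dec_; ¬?)
open import Function.Bundles using (_⇔_; mk⇔; Equivalence)
open import Function.Definitions using (Injective)
open import Function using (_∘_; id)
open import Data.List.Properties using (++-assoc; ++-identityʳ; map-++; ∷-injective)
open import Data.List.Relation.Ternary.Interleaving.Propositional as Interleaving using (Interleaving; []; consˡ; consʳ)
open import Data.List.Relation.Unary.AllPairs using (AllPairs; []; _∷_)
import Data.List.Relation.Unary.AllPairs.Properties as AllPairs
open import Data.List.Relation.Unary.Unique.Propositional using (Unique)
import Data.List.Relation.Unary.Unique.Propositional.Properties as Unique
open import Induction.WellFounded using (Acc; acc)
import Data.Fin.Induction as Fin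
open import Relation.Binary.Construct.Closure.ReflexiveTransitive as Star using (Star) renaming (ε to ⟨⟩; _◅_ to _◂_)

-- Two tours cannot simply be concatenated: the action that performs the last flip of the first one
-- is also the action that pops the stack, so how a tour ends depends on what follows it. Runs are
-- therefore built from the back. `Tour` and `Finish` carry the run that is still to come, and the
-- tour of the later component is constructed before that of the earlier one. The factor 2 is a
-- credit of two actions per flip, of which the flip itself uses one. `Conquers` must promise one
-- action in reserve: when two components remain, the reserve of the first tour is spent on the move
-- away from the popped edge. Flips are indices into the original sequence, and the triangles that
-- each consumes and produces are fixed once and for all, so a reordering never changes them.
-- Dependence means naming a common triangle, which is symmetric and does not refer to the current
-- state. That this is no coarser than causality between consecutive flips is
-- `consecutive-independent`.

module FieldProperties (K : OrderedField) where
  open OrderedField K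

  -- A ring solver for the coordinates.

  commutativeRing : CommutativeRing 0ℓ 0ℓ
  commutativeRing = record { isCommutativeRing = isCommutativeRing }

  open CommutativeRing commutativeRing public
    using (+-assoc; +-comm; +-identityˡ; +-identityʳ; -‿inverseˡ; -‿inverseʳ;
           *-assoc; *-comm; *-identityˡ; *-identityʳ; zeroˡ; zeroʳ; ring; semiring; +-abelianGroup)
  open Algebra.Properties.Ring ring public using (-‿distribˡ-*; -‿distribʳ-*; -0#≈0#; -‿involutive)
  open Algebra.Properties.AbelianGroup +-abelianGroup using (⁻¹-∙-comm)
  open Algebra.Properties.Semiring.Mult semiring using (×-homo-+; ×1-homo-*) renaming (_×_ to _·_)
  open IsStrictTotalOrder isStrictTotalOrder public
    using (compare) renaming (trans to <-trans; irrefl to <-irrefl; asym to <-asym)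

  almostCommutativeRing : AlmostCommutativeRing 0ℓ 0ℓ
  almostCommutativeRing = fromCommutativeRing commutativeRing

  open ≡-Reasoning

  -- Integer coefficients let the solver compare coefficients by computation; equality in the
  -- abstract `Carrier` does not reduce.
  fromℤ : ℤ → Carrier
  fromℤ (ℤ.+ n)      = n · 1#
  fromℤ (-[1+ n ]) = - (suc n · 1#)

  fromSign : Sign → Carrier
  fromSign Sign.+ = 1#
  fromSign Sign.- = - 1#

  -1*x : ∀ x → - 1# * x ≡ - x
  -1*x x = trans (sym (-‿distribˡ-* 1# x)) (cong -_ (*-identityˡ x))

  fromℤ-⊖ : ∀ m n → fromℤ (m ⊖ n) ≡ (m · 1#) - (n · 1#)
  fromℤ-⊖ zero    zero    = sym (-‿inverseʳ 0#)
  fromℤ-⊖ (suc m) zero    = sym (trans (cong ((suc m · 1#) +_) -0#≈0#) (+-identityʳ _))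
  fromℤ-⊖ zero    (suc n) = sym (+-identityˡ _)
  fromℤ-⊖ (suc m) (suc n) = begin
    fromℤ (suc m ⊖ suc n)                     ≡⟨ cong fromℤ (ℤ.[1+m]⊖[1+n]≡m⊖n m n) ⟩
    fromℤ (m ⊖ n)                             ≡⟨ fromℤ-⊖ m n ⟩
    x - y                                     ≡⟨ cong (_- y) (sym (+-identityˡ x)) ⟩
    (0# + x) - y                              ≡⟨ cong (λ z → (z + x) - y) (sym (-‿inverseˡ 1#)) ⟩
    (((- 1#) + 1#) + x) - y                   ≡⟨ cong (_- y) (+-assoc (- 1#) 1# x) ⟩
    ((- 1#) + (1# + x)) - y                   ≡⟨ cong (_- y) (+-comm (- 1#) (1# + x)) ⟩
    ((1# + x) + (- 1#)) - y                   ≡⟨ +-assoc (1# + x) (- 1#) (- y) ⟩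
    (1# + x) + ((- 1#) + (- y))               ≡⟨ cong ((1# + x) +_) (⁻¹-∙-comm 1# y) ⟩
    (suc m · 1#) - (suc n · 1#)               ∎
    where x = m · 1#
          y = n · 1#

  fromℤ-+ : ∀ i j → fromℤ (i ℤ.+ j) ≡ fromℤ i + fromℤ j
  fromℤ-+ (ℤ.+ m)      (ℤ.+ n)      = ×-homo-+ 1# m n
  fromℤ-+ (ℤ.+ m)      (-[1+ n ]) = fromℤ-⊖ m (suc n)
  fromℤ-+ (-[1+ m ]) (ℤ.+ n)      = trans (fromℤ-⊖ n (suc m)) (+-comm _ _)
  fromℤ-+ (-[1+ m ]) (-[1+ n ]) = trans
    (cong -_ (trans (cong (1# +_) (×-homo-+ 1# (suc m) n))
      (trans (+-comm 1# _) (trans (+-assoc _ _ _) (cong ((suc m · 1#) +_) (+-comm _ 1#))))))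
    (sym (⁻¹-∙-comm _ _))

  fromℤ-◃ : ∀ s n → fromℤ (s ℤ.◃ n) ≡ fromSign s * (n · 1#)
  fromℤ-◃ Sign.+ zero    = sym (zeroʳ _)
  fromℤ-◃ Sign.+ (suc n) = sym (*-identityˡ _)
  fromℤ-◃ Sign.- zero    = sym (zeroʳ _)
  fromℤ-◃ Sign.- (suc n) = sym (-1*x _)

  fromSign-* : ∀ s t → fromSign (s Sign.* t) ≡ fromSign s * fromSign t
  fromSign-* Sign.+ t      = sym (*-identityˡ _)
  fromSign-* Sign.- Sign.+ = sym (*-identityʳ _)
  fromSign-* Sign.- Sign.- = sym (trans (-1*x _) (-‿involutive 1#))

  interchange : ∀ a b c d → (a * b) * (c * d) ≡ (a * c) * (b * d)
  interchange a b c d = begin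
    (a * b) * (c * d) ≡⟨ *-assoc a b (c * d) ⟩
    a * (b * (c * d)) ≡⟨ cong (a *_) (sym (*-assoc b c d)) ⟩
    a * ((b * c) * d) ≡⟨ cong (λ z → a * (z * d)) (*-comm b c) ⟩
    a * ((c * b) * d) ≡⟨ cong (a *_) (*-assoc c b d) ⟩
    a * (c * (b * d)) ≡⟨ sym (*-assoc a c (b * d)) ⟩
    (a * c) * (b * d) ∎

  fromℤ-signAbs : ∀ i → fromℤ i ≡ fromSign (ℤ.sign i) * (ℤ.∣ i ∣ · 1#)
  fromℤ-signAbs (ℤ.+ n)      = sym (*-identityˡ _)
  fromℤ-signAbs (-[1+ n ]) = sym (-1*x _)

  fromℤ-* : ∀ i j → fromℤ (i ℤ.* j) ≡ fromℤ i * fromℤ j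
  fromℤ-* i j = begin
    fromℤ ((si Sign.* sj) ℤ.◃ (m ℕ.* n))        ≡⟨ fromℤ-◃ (si Sign.* sj) (m ℕ.* n) ⟩
    fromSign (si Sign.* sj) * ((m ℕ.* n) · 1#)  ≡⟨ cong₂ _*_ (fromSign-* si sj) (×1-homo-* m n) ⟩
    (fromSign si * fromSign sj) * ((m · 1#) * (n · 1#)) ≡⟨ interchange _ _ _ _ ⟩
    (fromSign si * (m · 1#)) * (fromSign sj * (n · 1#))
      ≡⟨ sym (cong₂ _*_ (fromℤ-signAbs i) (fromℤ-signAbs j)) ⟩
    fromℤ i * fromℤ j ∎
    where si = ℤ.sign i
          sj = ℤ.sign j
          m = ℤ.∣ i ∣
          n = ℤ.∣ j ∣

  fromℤ-neg : ∀ i → fromℤ (ℤ.- i) ≡ - fromℤ i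
  fromℤ-neg (ℤ.+ zero)   = sym -0#≈0#
  fromℤ-neg (ℤ.+ suc n)  = refl
  fromℤ-neg (-[1+ n ]) = sym (-‿involutive _)

  fromℤ-morphism : ℤ.+-*-rawRing -Raw-AlmostCommutative⟶ almostCommutativeRing
  fromℤ-morphism = record
    { ⟦_⟧ = fromℤ ; +-homo = fromℤ-+ ; *-homo = fromℤ-* ; -‿homo = fromℤ-neg
    ; 0-homo = refl ; 1-homo = +-identityʳ 1# }

  fromℤ-≟ : WeaklyDecidable (Induced-equivalence fromℤ-morphism)
  fromℤ-≟ i j with i ℤ.≟ j
  ... | yes i≡j = just (cong fromℤ i≡j)
  ... | no  _   = nothing

  open Algebra.Solver.Ring ℤ.+-*-rawRing almostCommutativeRing fromℤ-morphism
    fromℤ-≟ public using (Polynomial; solve; _:+_; _:*_; _:-_; :-_; _:=_; con)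

  open Geometry K using (Point; orient)

  -- Identities between orientations.

  orientₚ : ∀ {n} → (p q r : Polynomial n × Polynomial n) → Polynomial n
  orientₚ (ax , ay) (bx , by) (cx , cy) =
    ((bx :- ax) :* (cy :- ay)) :- ((by :- ay) :* (cx :- ax))

  orient-rotate : ∀ a b c → orient a b c ≡ orient b c a
  orient-rotate (ax , ay) (bx , by) (cx , cy) = solve 6
    (λ ax ay bx by cx cy → orientₚ (ax , ay) (bx , by) (cx , cy) := orientₚ (bx , by) (cx , cy) (ax , ay))
    refl ax ay bx by cx cy

  -- The three-term Grassmann-Plücker relation for the vectors from `c` to the other four points.
  orient-plücker : ∀ a b c d q →
    orient c d a * orient b c q ≡ orient c d q * orient a b c + orient a c q * orient c d b
  orient-plücker (ax , ay) (bx , by) (cx , cy) (dx , dy) (qx , qy) = solve 10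
    (λ ax ay bx by cx cy dx dy qx qy →
       let a = ax , ay ; b = bx , by ; c = cx , cy ; d = dx , dy ; q = qx , qy in
       (orientₚ c d a :* orientₚ b c q) := ((orientₚ c d q :* orientₚ a b c) :+ (orientₚ a c q :* orientₚ c d b)))
    refl ax ay bx by cx cy dx dy qx qy

  orient-swap : ∀ a b c → orient b a c ≡ - orient a b c
  orient-swap (ax , ay) (bx , by) (cx , cy) = solve 6
    (λ ax ay bx by cx cy → orientₚ (bx , by) (ax , ay) (cx , cy) := :- orientₚ (ax , ay) (bx , by) (cx , cy))
    refl ax ay bx by cx cy

  orient-degenerate : ∀ a b → orient a a b ≡ 0#
  orient-degenerate (ax , ay) (bx , by) = solve 4
    (λ ax ay bx by → orientₚ (ax , ay) (ax , ay) (bx , by) := con (ℤ.+ 0))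
    refl ax ay bx by

  -- Both sides are twice the signed area of the quadrilateral `a b c d`, cut along `a c` on the
  -- left and along `b d` on the right.
  orient-exchange : ∀ a b c d → orient a b c + orient c d a ≡ orient a b d + orient c d b
  orient-exchange (ax , ay) (bx , by) (cx , cy) (dx , dy) = solve 8
    (λ ax ay bx by cx cy dx dy → let a = ax , ay ; b = bx , by ; c = cx , cy ; d = dx , dy in
      (orientₚ a b c :+ orientₚ c d a) := (orientₚ a b d :+ orientₚ c d b))
    refl ax ay bx by cx cy dx dy

  abstract
    lerp : Carrier → Point → Point → Point
    lerp s (px , py) (qx , qy) = (px + (s * (qx - px))) , (py + (s * (qy - py)))

    -- The signed area is affine in its third point. This is all that is used about `lerp`.
    orient-lerp : ∀ a b s p q → orient a b (lerp s p q) ≡ orient a b p + s * (orient a b q - orient a b p)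
    orient-lerp (ax , ay) (bx , by) s (px , py) (qx , qy) = solve 9
      (λ ax ay bx by s px py qx qy → let a = ax , ay ; b = bx , by ; p = px , py ; q = qx , qy in
        orientₚ a b ((px :+ (s :* (qx :- px))) , (py :+ (s :* (qy :- py))))
          := (orientₚ a b p :+ (s :* (orientₚ a b q :- orientₚ a b p))))
      refl ax ay bx by s px py qx qy

  -- Signs of sums and products.

  +-pos : ∀ {x y} → 0# < x → 0# < y → 0# < x + y
  +-pos {x} {y} 0<x 0<y = <-trans 0<y (subst (_< x + y) (+-identityˡ y) (+-mono-< y 0<x))

  neg-pos : ∀ {x} → 0# < x → - x < 0#
  neg-pos {x} 0<x = subst₂ _<_ (+-identityˡ (- x)) (-‿inverseʳ x) (+-mono-< (- x) 0<x)

  pos-neg : ∀ {x} → x < 0# → 0# < - x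
  pos-neg {x} x<0 = subst₂ _<_ (-‿inverseʳ x) (+-identityˡ (- x)) (+-mono-< (- x) x<0)

  neg-pos⁻ : ∀ {x} → 0# < - x → x < 0#
  neg-pos⁻ 0<-x = subst (_< 0#) (-‿involutive _) (neg-pos 0<-x)

  pos-neg⁻ : ∀ {x} → - x < 0# → 0# < x
  pos-neg⁻ -x<0 = subst (0# <_) (-‿involutive _) (pos-neg -x<0)

  +-neg : ∀ {x y} → x < 0# → y < 0# → x + y < 0#
  +-neg {x} {y} x<0 y<0 = neg-pos⁻ (subst (0# <_) (⁻¹-∙-comm x y) (+-pos (pos-neg x<0) (pos-neg y<0)))

  *-pos-neg : ∀ {x y} → 0# < x → y < 0# → x * y < 0#
  *-pos-neg {x} {y} 0<x y<0 = neg-pos⁻ (subst (0# <_) (sym (-‿distribʳ-* x y)) (*-pos 0<x (pos-neg y<0)))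

  *-neg-pos : ∀ {x y} → x < 0# → 0# < y → x * y < 0#
  *-neg-pos x<0 0<y = subst (_< 0#) (*-comm _ _) (*-pos-neg 0<y x<0)

  *-neg-neg : ∀ {x y} → x < 0# → y < 0# → 0# < x * y
  *-neg-neg {x} {y} x<0 y<0 = pos-neg⁻ (subst (_< 0#) (sym (-‿distribˡ-* x y)) (*-pos-neg (pos-neg x<0) y<0))

  opposite-signs : ∀ {x y} → x * y < 0# → (0# < x × y < 0#) ⊎ (x < 0# × 0# < y)
  opposite-signs {x} {y} xy<0 with compare 0# x | compare 0# y
  ... | tri≈ _ refl _ | _ = ⊥-elim (<-irrefl (zeroˡ y) xy<0)
  ... | _ | tri≈ _ refl _ = ⊥-elim (<-irrefl (zeroʳ x) xy<0)
  ... | tri< 0<x _ _ | tri< 0<y _ _ = ⊥-elim (<-asym xy<0 (*-pos 0<x 0<y))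
  ... | tri< 0<x _ _ | tri> _ _ y<0 = inj₁ (0<x , y<0)
  ... | tri> _ _ x<0 | tri< 0<y _ _ = inj₂ (x<0 , 0<y)
  ... | tri> _ _ x<0 | tri> _ _ y<0 = ⊥-elim (<-asym xy<0 (*-neg-neg x<0 y<0))

  *-cancel-neg : ∀ {x y} → x < 0# → x * y < 0# → 0# < y
  *-cancel-neg x<0 xy<0 with opposite-signs xy<0
  ... | inj₁ (0<x , _) = ⊥-elim (<-asym x<0 0<x)
  ... | inj₂ (_ , 0<y) = 0<y

  0<1 : 0# < 1#
  0<1 with compare 0# 1#
  ... | tri< 0<1 _ _ = 0<1
  ... | tri≈ _ 0≡1 _ = ⊥-elim (0≢1 0≡1)
  ... | tri> _ _ 1<0 = subst (0# <_) (*-identityˡ 1#) (*-neg-neg 1<0 1<0)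

  -- Moving a point slightly without leaving finitely many half-planes.

  <-diff : ∀ {x y} → x < y → 0# < y - x
  <-diff {x} {y} x<y = subst (_< y - x) (-‿inverseʳ x) (+-mono-< (- x) x<y)

  -- The threshold for z < 0 is x / (x - z).
  small-multiples : ∀ {x} z → 0# < x → ∃[ δ ] (0# < δ × ∀ {s} → 0# < s → ¬ δ < s → 0# < x + s * z)
  small-multiples {x} z 0<x with compare z 0#
  ... | tri≈ _ refl _ = 1# , 0<1 , λ {s} _ _ → subst (0# <_) (sym (trans (cong (x +_) (zeroʳ s)) (+-identityʳ x))) 0<x
  ... | tri> _ _ 0<z = 1# , 0<1 , λ 0<s _ → +-pos 0<x (*-pos 0<s 0<z)
  ... | tri< z<0 _ _ = x * i , *-pos 0<x 0<i , bound
    where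
    w = x - z
    0<w : 0# < w
    0<w = +-pos 0<x (pos-neg z<0)
    i = proj₁ (inverse w λ w≡0 → <-irrefl (sym w≡0) 0<w)
    wi≡1 : w * i ≡ 1#
    wi≡1 = proj₂ (inverse w λ w≡0 → <-irrefl (sym w≡0) 0<w)
    0<i : 0# < i
    0<i with compare 0# i
    ... | tri< 0<i _ _ = 0<i
    ... | tri≈ _ 0≡i _ = ⊥-elim (0≢1 (trans (sym (trans (cong (w *_) (sym 0≡i)) (zeroʳ w))) wi≡1))
    ... | tri> _ _ i<0 = ⊥-elim (<-asym 0<1 (subst (_< 0#) wi≡1 (*-pos-neg 0<w i<0)))
    slack : ∀ s → x + s * z ≡ w * ((x * i) - s) + s * x
    slack s = sym (begin
      w * ((x * i) - s) + s * x
        ≡⟨ solve 4 (λ x z s i → (x :- z) :* ((x :* i) :- s) :+ s :* x := x :* ((x :- z) :* i) :+ s :* z) refl x z s i ⟩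
      x * (w * i) + s * z ≡⟨ cong (λ e → x * e + s * z) wi≡1 ⟩
      x * 1# + s * z      ≡⟨ cong (_+ s * z) (*-identityʳ x) ⟩
      x + s * z           ∎)
    bound : ∀ {s} → 0# < s → ¬ x * i < s → 0# < x + s * z
    bound {s} 0<s ¬δ<s with compare s (x * i)
    ... | tri< s<δ _ _ = subst (0# <_) (sym (slack s)) (+-pos (*-pos 0<w (<-diff s<δ)) (*-pos 0<s 0<x))
    ... | tri> _ _ δ<s = ⊥-elim (¬δ<s δ<s)
    ... | tri≈ _ refl _ = subst (0# <_) (sym (trans (slack s) (trans (cong (λ e → w * e + s * x) (-‿inverseʳ s))
                            (trans (cong (_+ s * x) (zeroʳ w)) (+-identityˡ _))))) (*-pos 0<s 0<x)

  -- A record rather than a synonym, so that the points can be inferred from the type.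
  record LeftOf (p : Point) (ab : Point × Point) : Set where
    constructor left
    field positive : 0# < orient (proj₁ ab) (proj₂ ab) p
  open LeftOf public

  -- The claim covers every positive `s` up to `δ`, not only `δ` itself, so that the thresholds of
  -- several half-planes can be merged by taking the smaller one.
  nudge-threshold : ∀ {p} q abs → All (LeftOf p) abs →
    ∃[ δ ] (0# < δ × ∀ {s} → 0# < s → ¬ δ < s → All (LeftOf (lerp s p q)) abs)
  nudge-threshold q [] [] = 1# , 0<1 , λ _ _ → []
  nudge-threshold {p} q ((a , b) ∷ abs) (left 0<abp ∷ lefts)
    with small-multiples (orient a b q - orient a b p) 0<abp | nudge-threshold q abs lefts
  ... | δ , 0<δ , near | δ′ , 0<δ′ , nears with compare δ δ′
  ... | tri< δ<δ′ _ _ = δ , 0<δ , λ {s} 0<s δ≮s →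
          left (subst (0# <_) (sym (orient-lerp a b s p q)) (near 0<s δ≮s)) ∷ nears 0<s λ δ′<s → δ≮s (<-trans δ<δ′ δ′<s)
  ... | tri≈ _ refl _ = δ , 0<δ , λ {s} 0<s δ≮s →
          left (subst (0# <_) (sym (orient-lerp a b s p q)) (near 0<s δ≮s)) ∷ nears 0<s δ≮s
  ... | tri> _ _ δ′<δ = δ′ , 0<δ′ , λ {s} 0<s δ′≮s →
          left (subst (0# <_) (sym (orient-lerp a b s p q)) (near 0<s λ δ<s → δ′≮s (<-trans δ′<δ δ<s))) ∷ nears 0<s δ′≮s

  nudge : ∀ {p} q abs → All (LeftOf p) abs → ∃[ s ] (0# < s × All (LeftOf (lerp s p q)) abs)
  nudge q abs lefts with nudge-threshold q abs lefts
  ... | δ , 0<δ , near = δ , 0<δ , near 0<δ (<-irrefl refl)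

  orient-sum : ∀ a b c q → orient a b c ≡ orient a b q + (orient b c q + orient c a q)
  orient-sum (ax , ay) (bx , by) (cx , cy) (qx , qy) = solve 8
    (λ ax ay bx by cx cy qx qy → let a = ax , ay ; b = bx , by ; c = cx , cy ; q = qx , qy in
      orientₚ a b c := (orientₚ a b q :+ (orientₚ b c q :+ orientₚ c a q)))
    refl ax ay bx by cx cy qx qy

  -- Shaped for the Plücker relation: when both products on the right are negative, the sign of one
  -- factor on the left determines that of the other.
  factor-positive : ∀ x y p q r s → x * y ≡ p * q + r * s → x < 0# → p < 0# → 0# < q → r < 0# → 0# < s → 0# < y
  factor-positive x y p q r s eq x<0 p<0 0<q r<0 0<s =
    *-cancel-neg x<0 (subst (_< 0#) (sym eq) (+-neg (*-neg-pos p<0 0<q) (*-neg-pos r<0 0<s)))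

  factor-negative : ∀ x y p q r s → x * y ≡ p * q + r * s → 0# < x → 0# < p → q < 0# → 0# < r → s < 0# → y < 0#
  factor-negative x y p q r s eq 0<x 0<p q<0 0<r s<0
    with opposite-signs (subst (_< 0#) (sym eq) (+-neg (*-pos-neg 0<p q<0) (*-pos-neg 0<r s<0)))
  ... | inj₁ (_ , y<0) = y<0
  ... | inj₂ (x<0 , _) = ⊥-elim (<-asym x<0 0<x)

-- Triangles and edges as labelled vertex sets.

module TriangleProperties (K : OrderedField) (n : ℕ) (pt : Fin n → Geometry.Point K) where
  open OrderedField K
  open Geometry K using (Point; orient)
  open Geometry.PointSet K n pt
  open FieldProperties K

  _≟ᵉ_ : DecidableEquality Edge
  e ≟ᵉ f = map′ (λ { (refl , refl) → refl }) (λ { refl → refl , refl })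
               ((a e Fin.≟ a f) ×-dec (b e Fin.≟ b f))

  _≟ᵗ_ : DecidableEquality Triangle
  t ≟ᵗ u = map′ (λ { (refl , refl , refl) → refl }) (λ { refl → refl , refl , refl })
               ((v1 t Fin.≟ v1 u) ×-dec ((v2 t Fin.≟ v2 u) ×-dec (v3 t Fin.≟ v3 u)))

  vertexOf? : ∀ i t → Dec (VertexOf i t)
  vertexOf? i t = (i Fin.≟ v1 t) ⊎-dec ((i Fin.≟ v2 t) ⊎-dec (i Fin.≟ v3 t))

  edgeOf? : ∀ e t → Dec (EdgeOf e t)
  edgeOf? e t = vertexOf? (a e) t ×-dec vertexOf? (b e) t

  a≢b : ∀ e → a e ≢ b e
  a≢b (edge i j i<j) i≡j = Irr.⊥-elim (Fin.<-irrefl i≡j i<j)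

  v1≢v2 : ∀ t → v1 t ≢ v2 t
  v1≢v2 (triangle x y z x<y y<z) x≡y = Irr.⊥-elim (Fin.<-irrefl x≡y x<y)

  v2≢v3 : ∀ t → v2 t ≢ v3 t
  v2≢v3 (triangle x y z x<y y<z) y≡z = Irr.⊥-elim (Fin.<-irrefl y≡z y<z)

  v1≢v3 : ∀ t → v1 t ≢ v3 t
  v1≢v3 (triangle x y z x<y y<z) x≡z = Irr.⊥-elim (Fin.<-irrefl x≡z (Fin.<-trans {i = x} {y} {z} x<y y<z))

  -- A stored triangle lists its vertices in increasing order, while geometric arguments need
  -- arbitrary labels. The two fields are generators of the symmetric group on three points, so such
  -- a relation can be carried between any two labellings.
  record Symmetric₃ {A : Set} (P : A → A → A → Set) : Set where
    field
      rotate : ∀ {x y z} → P x y z → P y z x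
      flip   : ∀ {x y z} → P x y z → P y x z
  open Symmetric₃

  module _ {P : Fin n → Fin n → Fin n → Set} (sym₃ : Symmetric₃ P) where

    relabel : ∀ t {x y z} → HasVertices t x y z → P (v1 t) (v2 t) (v3 t) → P x y z
    relabel t {x} {y} {z} h p = cases (f _ (inj₁ refl)) (f _ (inj₂ (inj₁ refl))) (f _ (inj₂ (inj₂ refl)))
      where
      f : ∀ i → VertexOf i t → (i ≡ x) ⊎ (i ≡ y) ⊎ (i ≡ z)
      f i = Equivalence.to (h i)
      cases : (v1 t ≡ x) ⊎ (v1 t ≡ y) ⊎ (v1 t ≡ z) → (v2 t ≡ x) ⊎ (v2 t ≡ y) ⊎ (v2 t ≡ z) →
              (v3 t ≡ x) ⊎ (v3 t ≡ y) ⊎ (v3 t ≡ z) → P x y z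
      cases (inj₁ refl) (inj₂ (inj₁ refl)) (inj₂ (inj₂ refl)) = p
      cases (inj₁ refl) (inj₂ (inj₂ refl)) (inj₂ (inj₁ refl)) = flip sym₃ (rotate sym₃ (rotate sym₃ p))
      cases (inj₂ (inj₁ refl)) (inj₁ refl) (inj₂ (inj₂ refl)) = flip sym₃ p
      cases (inj₂ (inj₁ refl)) (inj₂ (inj₂ refl)) (inj₁ refl) = rotate sym₃ (rotate sym₃ p)
      cases (inj₂ (inj₂ refl)) (inj₁ refl) (inj₂ (inj₁ refl)) = rotate sym₃ p
      cases (inj₂ (inj₂ refl)) (inj₂ (inj₁ refl)) (inj₁ refl) = flip sym₃ (rotate sym₃ p)
      cases (inj₁ e) (inj₁ e′) _ = ⊥-elim (v1≢v2 t (trans e (sym e′)))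
      cases (inj₁ e) _ (inj₁ e′) = ⊥-elim (v1≢v3 t (trans e (sym e′)))
      cases _ (inj₁ e) (inj₁ e′) = ⊥-elim (v2≢v3 t (trans e (sym e′)))
      cases (inj₂ (inj₁ e)) (inj₂ (inj₁ e′)) _ = ⊥-elim (v1≢v2 t (trans e (sym e′)))
      cases (inj₂ (inj₁ e)) _ (inj₂ (inj₁ e′)) = ⊥-elim (v1≢v3 t (trans e (sym e′)))
      cases _ (inj₂ (inj₁ e)) (inj₂ (inj₁ e′)) = ⊥-elim (v2≢v3 t (trans e (sym e′)))
      cases (inj₂ (inj₂ e)) (inj₂ (inj₂ e′)) _ = ⊥-elim (v1≢v2 t (trans e (sym e′)))
      cases (inj₂ (inj₂ e)) _ (inj₂ (inj₂ e′)) = ⊥-elim (v1≢v3 t (trans e (sym e′)))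
      cases _ (inj₂ (inj₂ e)) (inj₂ (inj₂ e′)) = ⊥-elim (v2≢v3 t (trans e (sym e′)))

  -- The converse direction is again an instance of `relabel`, applied to the predicate "`P` here
  -- implies `P` at the stored labels".
  unlabel : {P : Fin n → Fin n → Fin n → Set} → Symmetric₃ P →
            ∀ t {x y z} → HasVertices t x y z → P x y z → P (v1 t) (v2 t) (v3 t)
  unlabel {P} sym₃ t h = relabel {λ x y z → P x y z → P (v1 t) (v2 t) (v3 t)}
    (record { rotate = λ g p → g (rotate sym₃ (rotate sym₃ p)) ; flip = λ g p → g (flip sym₃ p) }) t h id

  labels-symmetric : ∀ {t} → Symmetric₃ (HasVertices t)
  labels-symmetric = record
    { rotate = λ h i → mk⇔ (λ v → case₁ (Equivalence.to (h i) v)) (λ v → Equivalence.from (h i) (case₂ v))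
    ; flip   = λ h i → mk⇔ (λ v → case₃ (Equivalence.to (h i) v)) (λ v → Equivalence.from (h i) (case₃ v)) }
    where
    case₁ : ∀ {A B C : Set} → A ⊎ B ⊎ C → B ⊎ C ⊎ A
    case₁ = [ inj₂ ∘ inj₂ , [ inj₁ , inj₂ ∘ inj₁ ]′ ]′
    case₂ : ∀ {A B C : Set} → B ⊎ C ⊎ A → A ⊎ B ⊎ C
    case₂ = [ inj₂ ∘ inj₁ , [ inj₂ ∘ inj₂ , inj₁ ]′ ]′
    case₃ : ∀ {A B C : Set} → A ⊎ B ⊎ C → B ⊎ A ⊎ C
    case₃ = [ inj₂ ∘ inj₁ , [ inj₁ , inj₂ ∘ inj₂ ]′ ]′

  rotate-labels : ∀ {t x y z} → HasVertices t x y z → HasVertices t y z x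
  rotate-labels {t} = rotate (labels-symmetric {t})

  flip-labels : ∀ {t x y z} → HasVertices t x y z → HasVertices t y x z
  flip-labels {t} = flip (labels-symmetric {t})

  own-labels : ∀ t → HasVertices t (v1 t) (v2 t) (v3 t)
  own-labels t i = mk⇔ id id

  triangle-with : ∀ x y z → x ≢ y → y ≢ z → z ≢ x → ∃[ t ] HasVertices t x y z
  triangle-with x y z x≢y y≢z z≢x with Fin.<-cmp x y | Fin.<-cmp y z | Fin.<-cmp z x
  ... | tri≈ _ e _ | _ | _ = ⊥-elim (x≢y e)
  ... | _ | tri≈ _ e _ | _ = ⊥-elim (y≢z e)
  ... | _ | _ | tri≈ _ e _ = ⊥-elim (z≢x e)
  ... | tri< p _ _ | tri< q _ _ | _ = let t = triangle x y z p q in t , own-labels t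
  ... | tri< p _ _ | tri> _ _ q | tri< r _ _ = let t = triangle z x y r p in t , rotate-labels {t} (own-labels t)
  ... | tri< p _ _ | tri> _ _ q | tri> _ _ r = let t = triangle x z y r q in t , flip-labels {t} (rotate-labels {t} (rotate-labels {t} (own-labels t)))
  ... | tri> _ _ p | tri< q _ _ | tri< r _ _ = let t = triangle y z x q r in t , rotate-labels {t} (rotate-labels {t} (own-labels t))
  ... | tri> _ _ p | tri< q _ _ | tri> _ _ r = let t = triangle y x z p r in t , flip-labels {t} (own-labels t)
  ... | tri> _ _ p | tri> _ _ q | _ = let t = triangle z y x q p in t , flip-labels {t} (rotate-labels {t} (own-labels t))

  private
    -- The order of the vertices is stored irrelevantly, so the conclusion is decided first and the
    -- stored proofs serve only to refute the negative answer.
    v1-least : ∀ t {i} → VertexOf i t → v1 t Fin.≤ i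
    v1-least (triangle x y z p q) {i} v with x Fin.≤? i
    ... | yes x≤i = x≤i
    ... | no  x≰i = Irr.⊥-elim (x≰i (least p q v))
      where
      least : x Fin.< y → y Fin.< z → (i ≡ x) ⊎ (i ≡ y) ⊎ (i ≡ z) → x Fin.≤ i
      least p q (inj₁ refl) = Fin.≤-refl
      least p q (inj₂ (inj₁ refl)) = ℕₚ.<⇒≤ p
      least p q (inj₂ (inj₂ refl)) = ℕₚ.<⇒≤ (Fin.<-trans {i = x} {y} {z} p q)

    v3-greatest : ∀ t {i} → VertexOf i t → i Fin.≤ v3 t
    v3-greatest (triangle x y z p q) {i} v with i Fin.≤? z
    ... | yes i≤z = i≤z
    ... | no  i≰z = Irr.⊥-elim (i≰z (greatest p q v))
      where
      greatest : x Fin.< y → y Fin.< z → (i ≡ x) ⊎ (i ≡ y) ⊎ (i ≡ z) → i Fin.≤ z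
      greatest p q (inj₂ (inj₂ refl)) = Fin.≤-refl
      greatest p q (inj₂ (inj₁ refl)) = ℕₚ.<⇒≤ q
      greatest p q (inj₁ refl) = ℕₚ.<⇒≤ (Fin.<-trans {i = x} {y} {z} p q)

  same-vertices : ∀ t u → (∀ i → VertexOf i t ⇔ VertexOf i u) → t ≡ u
  same-vertices t u h = triangle-≡ v1≡ (middle (Equivalence.to (h _) (inj₂ (inj₁ refl)))) v3≡
    where
    triangle-≡ : v1 t ≡ v1 u → v2 t ≡ v2 u → v3 t ≡ v3 u → t ≡ u
    triangle-≡ refl refl refl = refl
    v1≡ : v1 t ≡ v1 u
    v1≡ = Fin.≤-antisym (v1-least t (Equivalence.from (h _) (inj₁ refl)))
                        (v1-least u (Equivalence.to (h _) (inj₁ refl)))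
    v3≡ : v3 t ≡ v3 u
    v3≡ = Fin.≤-antisym (v3-greatest u (Equivalence.to (h _) (inj₂ (inj₂ refl))))
                        (v3-greatest t (Equivalence.from (h _) (inj₂ (inj₂ refl))))
    middle : VertexOf (v2 t) u → v2 t ≡ v2 u
    middle (inj₁ e)        = ⊥-elim (v1≢v2 t (trans v1≡ (sym e)))
    middle (inj₂ (inj₁ e)) = e
    middle (inj₂ (inj₂ e)) = ⊥-elim (v2≢v3 t (trans e (sym v3≡)))

  labels-injective : ∀ {t u x y z} → HasVertices t x y z → HasVertices u x y z → t ≡ u
  labels-injective {t} {u} h g = same-vertices t u λ i →
    mk⇔ (Equivalence.from (g i) ∘ Equivalence.to (h i)) (Equivalence.from (h i) ∘ Equivalence.to (g i))

  third-vertex : ∀ {t x y} → x ≢ y → VertexOf x t → VertexOf y t → ∃[ z ] HasVertices t x y z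
  third-vertex {t} x≢y (inj₁ refl) (inj₁ refl) = ⊥-elim (x≢y refl)
  third-vertex {t} x≢y (inj₁ refl) (inj₂ (inj₁ refl)) = _ , own-labels t
  third-vertex {t} x≢y (inj₁ refl) (inj₂ (inj₂ refl)) = _ , flip-labels {t} (rotate-labels {t} (rotate-labels {t} (own-labels t)))
  third-vertex {t} x≢y (inj₂ (inj₁ refl)) (inj₁ refl) = _ , flip-labels {t} (own-labels t)
  third-vertex {t} x≢y (inj₂ (inj₁ refl)) (inj₂ (inj₁ refl)) = ⊥-elim (x≢y refl)
  third-vertex {t} x≢y (inj₂ (inj₁ refl)) (inj₂ (inj₂ refl)) = _ , rotate-labels {t} (own-labels t)
  third-vertex {t} x≢y (inj₂ (inj₂ refl)) (inj₁ refl) = _ , rotate-labels {t} (rotate-labels {t} (own-labels t))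
  third-vertex {t} x≢y (inj₂ (inj₂ refl)) (inj₂ (inj₁ refl)) = _ , flip-labels {t} (rotate-labels {t} (own-labels t))
  third-vertex {t} x≢y (inj₂ (inj₂ refl)) (inj₂ (inj₂ refl)) = ⊥-elim (x≢y refl)

  EndsAt : Edge → Fin n → Fin n → Set
  EndsAt e x y = ((a e ≡ x) × (b e ≡ y)) ⊎ ((a e ≡ y) × (b e ≡ x))

  ends-unique : ∀ {e f x y} → EndsAt e x y → EndsAt f x y → e ≡ f
  ends-unique (inj₁ (refl , refl)) (inj₁ (refl , refl)) = refl
  ends-unique (inj₂ (refl , refl)) (inj₂ (refl , refl)) = refl
  ends-unique {edge i j i<j} {edge _ _ j<i} (inj₁ (refl , refl)) (inj₂ (refl , refl)) = Irr.⊥-elim (Fin.<-asym i<j j<i)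
  ends-unique {edge i j i<j} {edge _ _ j<i} (inj₂ (refl , refl)) (inj₁ (refl , refl)) = Irr.⊥-elim (Fin.<-asym i<j j<i)

  edge-between : ∀ {x y} → x ≢ y → ∃[ e ] EndsAt e x y
  edge-between {x} {y} x≢y with Fin.<-cmp x y
  ... | tri< x<y _ _ = edge x y x<y , inj₁ (refl , refl)
  ... | tri≈ _ x≡y _ = ⊥-elim (x≢y x≡y)
  ... | tri> _ _ y<x = edge y x y<x , inj₂ (refl , refl)

  ends-edgeOf : ∀ {e x y t} → EndsAt e x y → VertexOf x t → VertexOf y t → EdgeOf e t
  ends-edgeOf (inj₁ (refl , refl)) v w = v , w
  ends-edgeOf (inj₂ (refl , refl)) v w = w , v

  edgeOf-ends : ∀ {e x y t} → EndsAt e x y → EdgeOf e t → VertexOf x t × VertexOf y t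
  edgeOf-ends (inj₁ (refl , refl)) (v , w) = v , w
  edgeOf-ends (inj₂ (refl , refl)) (v , w) = w , v

  label₁ : ∀ {t x y z} → HasVertices t x y z → VertexOf x t
  label₁ h = Equivalence.from (h _) (inj₁ refl)

  label₂ : ∀ {t x y z} → HasVertices t x y z → VertexOf y t
  label₂ h = Equivalence.from (h _) (inj₂ (inj₁ refl))

  label₃ : ∀ {t x y z} → HasVertices t x y z → VertexOf z t
  label₃ h = Equivalence.from (h _) (inj₂ (inj₂ refl))

  not-vertex : ∀ t {x y z i} → HasVertices t x y z → i ≢ x → i ≢ y → i ≢ z → ¬ VertexOf i t
  not-vertex t h i≢x i≢y i≢z v = [ i≢x , [ i≢y , i≢z ]′ ]′ (Equivalence.to (h _) v)

  other-edge : ∀ {e g t x y z} → EndsAt e x y → HasVertices t x y z → EdgeOf g t → g ≢ e →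
               EndsAt g z x ⊎ EndsAt g z y
  other-edge {e} {g} {t} {x} {y} {z} ends h (v , w) g≢e = cases (Equivalence.to (h _) v) (Equivalence.to (h _) w)
    where
    cases : (a g ≡ x) ⊎ (a g ≡ y) ⊎ (a g ≡ z) → (b g ≡ x) ⊎ (b g ≡ y) ⊎ (b g ≡ z) → EndsAt g z x ⊎ EndsAt g z y
    cases (inj₁ p) (inj₁ q) = ⊥-elim (a≢b g (trans p (sym q)))
    cases (inj₁ p) (inj₂ (inj₁ q)) = ⊥-elim (g≢e (ends-unique (inj₁ (p , q)) ends))
    cases (inj₁ p) (inj₂ (inj₂ q)) = inj₁ (inj₂ (p , q))
    cases (inj₂ (inj₁ p)) (inj₁ q) = ⊥-elim (g≢e (ends-unique (inj₂ (p , q)) ends))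
    cases (inj₂ (inj₁ p)) (inj₂ (inj₁ q)) = ⊥-elim (a≢b g (trans p (sym q)))
    cases (inj₂ (inj₁ p)) (inj₂ (inj₂ q)) = inj₂ (inj₂ (p , q))
    cases (inj₂ (inj₂ p)) (inj₁ q) = inj₁ (inj₁ (p , q))
    cases (inj₂ (inj₂ p)) (inj₂ (inj₁ q)) = inj₂ (inj₁ (p , q))
    cases (inj₂ (inj₂ p)) (inj₂ (inj₂ q)) = ⊥-elim (a≢b g (trans p (sym q)))

  -- Interiors of triangles.

  left-swap : ∀ p a b → orient a b p < 0# → LeftOf p (b , a)
  left-swap p a b abp<0 = left (subst (0# <_) (sym (orient-swap a b p)) (pos-neg abp<0))

  right-swap : ∀ {p a b} → LeftOf p (a , b) → orient b a p < 0#
  right-swap {p} {a} {b} (left 0<abp) = subst (_< 0#) (sym (orient-swap a b p)) (neg-pos 0<abp)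

  CCW : Point → Point → Point → Point → Set
  CCW q x y z = All (LeftOf q) ((x , y) ∷ (y , z) ∷ (z , x) ∷ [])

  Inside : Point → Point → Point → Point → Set
  Inside q x y z = CCW q x y z ⊎ CCW q y x z

  inside-symmetric : ∀ {q} → Symmetric₃ (Inside q)
  inside-symmetric = record
    { rotate = Sum.map (λ { (p ∷ q ∷ r ∷ []) → q ∷ r ∷ p ∷ [] }) (λ { (p ∷ q ∷ r ∷ []) → r ∷ p ∷ q ∷ [] })
    ; flip   = swap }

  -- Seen from `q`, the triangle is composed of three triangles of positive signed area.
  ccw-orient : ∀ {q x y z} → CCW q x y z → LeftOf z (x , y)
  ccw-orient {q} {x} {y} {z} (left p ∷ left p′ ∷ left p″ ∷ []) =
    left (subst (0# <_) (sym (orient-sum x y z q)) (+-pos p (+-pos p′ p″)))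

  inside-ccw : ∀ {q x y z} → LeftOf z (x , y) → Inside q x y z → CCW q x y z
  inside-ccw xyz (inj₁ ccw) = ccw
  inside-ccw xyz (inj₂ ccw) = ⊥-elim (<-asym (right-swap xyz) (positive (ccw-orient ccw)))

  inside-cw : ∀ {q x y z} → LeftOf z (y , x) → Inside q x y z → CCW q y x z
  inside-cw yxz inside = inside-ccw yxz (swap inside)

  interior⇒inside : ∀ {q} t → InInterior q t → Inside q (pt (v1 t)) (pt (v2 t)) (pt (v3 t))
  interior⇒inside t (inj₁ (p , p′ , p″)) = inj₁ (left p ∷ left p′ ∷ left p″ ∷ [])
  interior⇒inside {q} t (inj₂ (p , p′ , p″)) =
    inj₂ (left-swap q (pt (v1 t)) (pt (v2 t)) p ∷ left-swap q (pt (v3 t)) (pt (v1 t)) p″ ∷ left-swap q (pt (v2 t)) (pt (v3 t)) p′ ∷ [])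

  inside⇒interior : ∀ {q} t → Inside q (pt (v1 t)) (pt (v2 t)) (pt (v3 t)) → InInterior q t
  inside⇒interior t (inj₁ (left p ∷ left p′ ∷ left p″ ∷ [])) = inj₁ (p , p′ , p″)
  inside⇒interior t (inj₂ (p ∷ p″ ∷ p′ ∷ [])) = inj₂ (right-swap p , right-swap p′ , right-swap p″)

  orientᵢ : Fin n → Fin n → Fin n → Carrier
  orientᵢ x y z = orient (pt x) (pt y) (pt z)

  Insideᵢ : Point → Fin n → Fin n → Fin n → Set
  Insideᵢ q x y z = Inside q (pt x) (pt y) (pt z)

  insideᵢ-symmetric : ∀ {q} → Symmetric₃ (Insideᵢ q)
  insideᵢ-symmetric = record { rotate = rotate inside-symmetric ; flip = flip inside-symmetric }

  interior⇒insideᵢ : ∀ {q t x y z} → HasVertices t x y z → InInterior q t → Insideᵢ q x y z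
  interior⇒insideᵢ {q} {t} h i = relabel insideᵢ-symmetric t h (interior⇒inside t i)

  insideᵢ⇒interior : ∀ {q t x y z} → HasVertices t x y z → Insideᵢ q x y z → InInterior q t
  insideᵢ⇒interior {q} {t} h i = inside⇒interior t (unlabel insideᵢ-symmetric t h i)

  degenerate₂ : ∀ x y → orient x y y ≡ 0#
  degenerate₂ x y = trans (orient-rotate x y y) (orient-degenerate y x)

  degenerate₃ : ∀ x y → orient x y x ≡ 0#
  degenerate₃ x y = trans (orient-rotate x y x) (degenerate₂ y x)

  lerp-off-line : ∀ s p x y q → orient x y p ≡ 0# → 0# < s → LeftOf q (x , y) → LeftOf (lerp s p q) (x , y)
  lerp-off-line s p x y q xyp≡0 0<s (left 0<xyq) = left (subst (0# <_) (sym (begin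
      orient x y (lerp s p q)                              ≡⟨ orient-lerp x y s p q ⟩
      orient x y p + s * (orient x y q - orient x y p)     ≡⟨ cong (λ o → o + s * (orient x y q - o)) xyp≡0 ⟩
      0# + s * (orient x y q - 0#)                         ≡⟨ solve 2 (λ s o → con (ℤ.+ 0) :+ (s :* (o :- con (ℤ.+ 0))) := s :* o) refl s (orient x y q) ⟩
      s * orient x y q                                     ∎)) (*-pos 0<s 0<xyq))
    where open ≡-Reasoning

  lerp-on-line : ∀ s x y → orient x y (lerp s x y) ≡ 0#
  lerp-on-line s x y = begin
      orient x y (lerp s x y)                          ≡⟨ orient-lerp x y s x y ⟩
      orient x y x + s * (orient x y y - orient x y x) ≡⟨ cong₂ (λ o o′ → o + s * (o′ - o)) (degenerate₃ x y) (degenerate₂ x y) ⟩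
      0# + s * (0# - 0#)                               ≡⟨ solve 1 (λ s → con (ℤ.+ 0) :+ (s :* (con (ℤ.+ 0) :- con (ℤ.+ 0))) := con (ℤ.+ 0)) refl s ⟩
      0#                                               ∎
    where open ≡-Reasoning

  left-rotate : ∀ {x y z} → LeftOf z (x , y) → LeftOf x (y , z)
  left-rotate {x} {y} {z} (left 0<xyz) = left (subst (0# <_) (orient-rotate x y z) 0<xyz)

  -- Nondegenerate triangles with disjoint interiors.

  record Good (T : List Triangle) : Set where
    field
      nondegenerate : ∀ {t x y z} → t ∈ T → HasVertices t x y z → orientᵢ x y z ≢ 0#
      disjoint      : ∀ {t u} → t ∈ T → u ∈ T → t ≢ u → ∀ q → ¬ (InInterior q t × InInterior q u)

  nondegenerate-symmetric : Symmetric₃ (λ x y z → orientᵢ x y z ≢ 0#)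
  nondegenerate-symmetric = record
    { rotate = λ {x} {y} {z} xyz≢0 yzx≡0 → xyz≢0 (trans (orient-rotate (pt x) (pt y) (pt z)) yzx≡0)
    ; flip   = λ {x} {y} {z} xyz≢0 yxz≡0 → xyz≢0 (begin
        orientᵢ x y z     ≡⟨ orient-swap (pt y) (pt x) (pt z) ⟩
        - orientᵢ y x z   ≡⟨ cong -_ yxz≡0 ⟩
        - 0#              ≡⟨ -0#≈0# ⟩
        0#                ∎) }
    where open ≡-Reasoning

  triangulation-good : ∀ {T} → IsTriangulation T → Good T
  triangulation-good {T} tri = record
    { nondegenerate = λ {t} t∈T h → relabel {λ x y z → orientᵢ x y z ≢ 0#} nondegenerate-symmetric t h (IsTriangulation.nondegenerate tri t∈T)
    ; disjoint      = IsTriangulation.interiorsDisjoint tri }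

  -- The witness is a point just inside the edge xy.
  common-interior-point : ∀ {x y z w} → LeftOf z (x , y) → LeftOf w (x , y) → ∃[ q ] (CCW q x y z × CCW q x y w)
  common-interior-point {x} {y} {z} {w} xyz xyw = start (nudge y ((y , z) ∷ (y , w) ∷ []) (left-rotate xyz ∷ left-rotate xyw ∷ []))
    where
    push : ∀ s → 0# < s → ∃[ s′ ] (0# < s′ × All (LeftOf (lerp s′ (lerp s x y) z)) ((y , z) ∷ (z , x) ∷ (y , w) ∷ (w , x) ∷ [])) →
           ∃[ q ] (CCW q x y z × CCW q x y w)
    push s 0<s (s′ , 0<s′ , yzq ∷ zxq ∷ ywq ∷ wxq ∷ []) =
      lerp s′ (lerp s x y) z , (xyq ∷ yzq ∷ zxq ∷ []) , (xyq ∷ ywq ∷ wxq ∷ [])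
      where
      xyq : LeftOf (lerp s′ (lerp s x y) z) (x , y)
      xyq = lerp-off-line s′ (lerp s x y) x y z (lerp-on-line s x y) 0<s′ xyz
    start : ∃[ s ] (0# < s × All (LeftOf (lerp s x y)) ((y , z) ∷ (y , w) ∷ [])) →
            ∃[ q ] (CCW q x y z × CCW q x y w)
    start (s , 0<s , yzm ∷ ywm ∷ []) = push s 0<s (nudge z ((y , z) ∷ (z , x) ∷ (y , w) ∷ (w , x) ∷ []) 
          (yzm ∷ lerp-off-line s x z x y (degenerate₂ z x) 0<s (left-rotate (left-rotate xyz))
          ∷ ywm ∷ lerp-off-line s x w x y (degenerate₂ w x) 0<s (left-rotate (left-rotate xyw)) ∷ []))

  -- Two triangles on the same side of a common edge overlap just next to that edge.
  same-side-unique : ∀ {T t u x y z w} → Good T → t ∈ T → u ∈ T → HasVertices t x y z → HasVertices u x y w →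
                     LeftOf (pt z) (pt x , pt y) → LeftOf (pt w) (pt x , pt y) → t ≡ u
  same-side-unique {T} {t} {u} {x} {y} {z} {w} good t∈T u∈T ht hu xyz xyw with t ≟ᵗ u
  ... | yes t≡u = t≡u
  ... | no  t≢u = let q , inz , inw = common-interior-point xyz xyw in
    ⊥-elim (Good.disjoint good t∈T u∈T t≢u q
      (insideᵢ⇒interior {q} {t} ht (inj₁ inz) , insideᵢ⇒interior {q} {u} hu (inj₁ inw)))

  -- Convex quadrilaterals and their two diagonals.

  record Convex (x y z w : Fin n) : Set where
    constructor convex
    field
      xyz : LeftOf (pt z) (pt x , pt y)
      yxw : LeftOf (pt w) (pt y , pt x)
      wzx : LeftOf (pt x) (pt w , pt z)
      zwy : LeftOf (pt y) (pt z , pt w)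
  open Convex

  convex-turn : ∀ {x y z w} → Convex x y z w → Convex y x w z
  convex-turn c = convex (yxw c) (xyz c) (zwy c) (wzx c)

  crossing⇒convex : ∀ {x y z w} → ProperlyCross x y z w → Convex x y z w ⊎ Convex x y w z
  crossing⇒convex {x} {y} {z} {w} (xy , zw) with opposite-signs xy | opposite-signs zw
  ... | inj₁ (xyz , xyw) | inj₂ (zwx , zwy) =
    inj₁ (convex (left xyz) (left-swap (pt w) (pt x) (pt y) xyw) (left-swap (pt x) (pt z) (pt w) zwx) (left zwy))
  ... | inj₂ (xyz , xyw) | inj₁ (zwx , zwy) =
    inj₂ (convex (left xyw) (left-swap (pt z) (pt x) (pt y) xyz) (left zwx) (left-swap (pt y) (pt z) (pt w) zwy))
  -- In the two remaining sign patterns `orient-exchange` would equate a positive number with a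
  -- negative one.
  ... | inj₁ (xyz , xyw) | inj₁ (zwx , zwy) =
    ⊥-elim (<-asym (+-pos xyz zwx) (subst (_< 0#) (sym (orient-exchange (pt x) (pt y) (pt z) (pt w))) (+-neg xyw zwy)))
  ... | inj₂ (xyz , xyw) | inj₂ (zwx , zwy) =
    ⊥-elim (<-asym (+-neg xyz zwx) (subst (0# <_) (sym (orient-exchange (pt x) (pt y) (pt z) (pt w))) (+-pos xyw zwy)))

  convex⇒crossing : ∀ {x y z w} → Convex x y z w → ProperlyCross x y z w
  convex⇒crossing c = *-pos-neg (positive (xyz c)) (right-swap (yxw c)) , *-neg-pos (right-swap (wzx c)) (positive (zwy c))

  left-distinct : ∀ {x y z} → LeftOf (pt z) (pt x , pt y) → x ≢ y × y ≢ z × z ≢ x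
  left-distinct {x} {y} {z} (left 0<xyz) =
    (λ { refl → <-irrefl (sym (orient-degenerate (pt x) (pt z))) 0<xyz }) ,
    (λ { refl → <-irrefl (sym (degenerate₂ (pt x) (pt y))) 0<xyz }) ,
    (λ { refl → <-irrefl (sym (degenerate₃ (pt x) (pt y))) 0<xyz })

  -- The diagonal `x y` cuts the triangle `z w x` into a part inside `x y z` and a part inside
  -- `x y w`. The sides at `y` are not sides of `z w x`; the position of `q` relative to them comes
  -- from the Plücker relation.
  split-triangle : ∀ {x y z w q} → Convex x y z w → Insideᵢ q z w x → orient (pt x) (pt y) q ≢ 0# →
                   Insideᵢ q x y z ⊎ Insideᵢ q x y w
  split-triangle {x} {y} {z} {w} {q} c inside xyq≢0 with inside-cw {x = pt z} {y = pt w} (wzx c) inside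
  ... | wzq ∷ zxq ∷ xwq ∷ [] = side (compare 0# (orient X Y q))
    where
    X = pt x
    Y = pt y
    Z = pt z
    W = pt w
    yzq : 0# < orient Y Z q
    yzq = factor-positive (orient Z W X) (orient Y Z q) (orient Z W q) (orient X Y Z) (orient X Z q) (orient Z W Y)
      (orient-plücker X Y Z W q) (right-swap (wzx c)) (right-swap wzq) (positive (xyz c)) (right-swap zxq) (positive (zwy c))
    ywq : orient Y W q < 0#
    ywq = factor-negative (orient W Z X) (orient Y W q) (orient W Z q) (orient X Y W) (orient X W q) (orient W Z Y)
      (orient-plücker X Y W Z q) (positive (wzx c)) (positive wzq) (right-swap (yxw c)) (positive xwq) (right-swap (zwy c))
    side : Tri (0# < orient X Y q) (0# ≡ orient X Y q) (orient X Y q < 0#) → Insideᵢ q x y z ⊎ Insideᵢ q x y w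
    side (tri< 0<xyq _ _) = inj₁ (inj₁ (left 0<xyq ∷ left yzq ∷ zxq ∷ []))
    side (tri≈ _ 0≡xyq _) = ⊥-elim (xyq≢0 (sym 0≡xyq))
    side (tri> _ _ xyq<0) = inj₂ (inj₂ (left-swap q X Y xyq<0 ∷ xwq ∷ left-swap q Y W ywq ∷ []))

  nudge-inside : ∀ {p x y z x′ y′ z′} q → Inside p x y z → Inside p x′ y′ z′ →
                 ∃[ s ] (0# < s × Inside (lerp s p q) x y z × Inside (lerp s p q) x′ y′ z′)
  nudge-inside {p} q inside inside′ with ccw-form inside | ccw-form inside′
    where
    ccw-form : ∀ {x y z} → Inside p x y z → ∃[ abs ] (All (LeftOf p) abs × (∀ {r} → All (LeftOf r) abs → Inside r x y z))
    ccw-form (inj₁ ccw) = _ , ccw , inj₁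
    ccw-form (inj₂ ccw) = _ , ccw , inj₂
  ... | abs , lefts , back | abs′ , lefts′ , back′ =
    let s , 0<s , lefts″ = nudge q (abs ++ abs′) (All.++⁺ lefts lefts′) in
    s , 0<s , back (All.++⁻ˡ abs lefts″) , back′ (All.++⁻ʳ abs lefts″)

  -- Interiors are open, so a point on the line can be moved off it towards `c` without leaving
  -- either triangle.
  avoid-line : ∀ {p x y z x′ y′ z′} a b c → LeftOf c (a , b) → Inside p x y z → Inside p x′ y′ z′ →
               ∃[ q ] (orient a b q ≢ 0# × Inside q x y z × Inside q x′ y′ z′)
  avoid-line {p} a b c abc inside inside′ with compare (orient a b p) 0#
  ... | tri< _ abp≢0 _ = p , abp≢0 , inside , inside′
  ... | tri> _ abp≢0 _ = p , abp≢0 , inside , inside′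
  ... | tri≈ _ abp≡0 _ = let s , 0<s , i , i′ = nudge-inside c inside inside′ in
    lerp s p c , (λ abq≡0 → <-irrefl (sym abq≡0) (positive (lerp-off-line s p a b c abp≡0 0<s abc))) , i , i′

  Fired : List Triangle → (t₁ t₂ u₁ u₂ : Triangle) → List Triangle → Set
  Fired T t₁ t₂ u₁ u₂ U = ∀ t → (t ∈ U) ⇔ ((t ∈ T × t ≢ t₁ × t ≢ t₂) ⊎ (t ≡ u₁) ⊎ (t ≡ u₂))

  record Quad (x y z w : Fin n) : Set where
    field
      t₁ t₂ u₁ u₂ : Triangle
      t₁-xyz : HasVertices t₁ x y z
      t₂-xyw : HasVertices t₂ x y w
      u₁-zwx : HasVertices u₁ z w x
      u₂-zwy : HasVertices u₂ z w y
      is-convex : Convex x y z w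

  module QuadProperties {x y z w} (Q : Quad x y z w) where
    open Quad Q

    private
      C = is-convex

    x≢y = proj₁ (left-distinct (xyz C))
    y≢z = proj₁ (proj₂ (left-distinct (xyz C)))
    z≢x = proj₂ (proj₂ (left-distinct (xyz C)))
    x≢w = proj₁ (proj₂ (left-distinct (yxw C)))
    w≢y = proj₂ (proj₂ (left-distinct (yxw C)))
    w≢z = proj₁ (left-distinct (wzx C))

    t₁≢t₂ : t₁ ≢ t₂
    t₁≢t₂ refl = not-vertex t₂ t₂-xyw z≢x (y≢z ∘ sym) (w≢z ∘ sym) (label₃ {t₁} t₁-xyz)

    u₁≢t₁ : u₁ ≢ t₁
    u₁≢t₁ refl = not-vertex t₁ t₁-xyz (x≢w ∘ sym) w≢y w≢z (label₂ {u₁} u₁-zwx)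

    -- A common point, moved off the diagonal `x y` if necessary, would lie inside `t₁` or `t₂`,
    -- both disjoint from `u`.
    new-triangle-disjoint : ∀ {T u} → Good T → t₁ ∈ T → t₂ ∈ T → u ∈ T → u ≢ t₁ → u ≢ t₂ →
                            ∀ q → ¬ (InInterior q u × InInterior q u₁)
    new-triangle-disjoint {u = u} good t₁∈T t₂∈T u∈T u≢t₁ u≢t₂ q (q∈u , q∈u₁)
      with avoid-line (pt x) (pt y) (pt z) (xyz C) (interior⇒inside u q∈u) (interior⇒insideᵢ {t = u₁} u₁-zwx q∈u₁)
    ... | q′ , xyq≢0 , q′∈u , q′∈zwx with split-triangle C q′∈zwx xyq≢0
    ... | inj₁ i = Good.disjoint good u∈T t₁∈T u≢t₁ q′ (inside⇒interior u q′∈u , insideᵢ⇒interior {q′} {t₁} t₁-xyz i)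
    ... | inj₂ i = Good.disjoint good u∈T t₂∈T u≢t₂ q′ (inside⇒interior u q′∈u , insideᵢ⇒interior {q′} {t₂} t₂-xyw i)

    new-triangles-disjoint : ∀ q → ¬ (InInterior q u₁ × InInterior q u₂)
    new-triangles-disjoint q (q∈u₁ , q∈u₂)
      with inside-cw {x = pt z} {y = pt w} (wzx C) (interior⇒insideᵢ {t = u₁} u₁-zwx q∈u₁)
         | inside-ccw {x = pt z} {y = pt w} (zwy C) (interior⇒insideᵢ {t = u₂} u₂-zwy q∈u₂)
    ... | wzq ∷ _ | zwq ∷ _ = <-asym (right-swap wzq) (positive zwq)

  -- Half a turn of the quadrilateral exchanges the two old triangles and the two new ones, so that
  -- each argument is made for only one of a pair.
  turn : ∀ {x y z w} → Quad x y z w → Quad y x w z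
  turn Q = record
    { t₁ = t₂ ; t₂ = t₁ ; u₁ = u₂ ; u₂ = u₁
    ; t₁-xyz = flip-labels {t₂} t₂-xyw ; t₂-xyw = flip-labels {t₁} t₁-xyz
    ; u₁-zwx = flip-labels {u₂} u₂-zwy ; u₂-zwy = flip-labels {u₁} u₁-zwx
    ; is-convex = convex-turn is-convex }
    where open Quad Q

  module _ {x y z w} (Q : Quad x y z w) where
    open Quad Q
    open QuadProperties Q

    private
      C = is-convex

    fired-good : ∀ {T U} → Good T → t₁ ∈ T → t₂ ∈ T → Fired T t₁ t₂ u₁ u₂ U → Good U
    fired-good {T} {U} good t₁∈T t₂∈T fired = record
      { nondegenerate = λ {t} t∈U h o≡0 → nondeg (Equivalence.to (fired t) t∈U) h o≡0
      ; disjoint = λ {t} {u} t∈U u∈U → disj (Equivalence.to (fired t) t∈U) (Equivalence.to (fired u) u∈U) }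
      where
      New : Triangle → Set
      New t = (t ∈ T × t ≢ t₁ × t ≢ t₂) ⊎ (t ≡ u₁) ⊎ (t ≡ u₂)
      zwx≢0 : orientᵢ z w x ≢ 0#
      zwx≢0 o≡0 = <-irrefl o≡0 (right-swap (wzx C))
      zwy≢0 : orientᵢ z w y ≢ 0#
      zwy≢0 o≡0 = <-irrefl (sym o≡0) (positive (zwy C))
      transfer : ∀ {t i j k i′ j′ k′} → HasVertices t i j k → orientᵢ i j k ≢ 0# → HasVertices t i′ j′ k′ → orientᵢ i′ j′ k′ ≢ 0#
      transfer {t} h o≢0 h′ = relabel {λ x y z → orientᵢ x y z ≢ 0#} nondegenerate-symmetric t h′
        (unlabel {λ x y z → orientᵢ x y z ≢ 0#} nondegenerate-symmetric t h o≢0)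
      nondeg : ∀ {t} → New t → ∀ {i j k} → HasVertices t i j k → orientᵢ i j k ≢ 0#
      nondeg (inj₁ (t∈T , _)) h = Good.nondegenerate good t∈T h
      nondeg (inj₂ (inj₁ refl)) h = transfer {u₁} u₁-zwx zwx≢0 h
      nondeg (inj₂ (inj₂ refl)) h = transfer {u₂} u₂-zwy zwy≢0 h
      disj : ∀ {t u} → New t → New u → t ≢ u → ∀ q → ¬ (InInterior q t × InInterior q u)
      disj (inj₁ (t∈T , _)) (inj₁ (u∈T , _)) t≢u q = Good.disjoint good t∈T u∈T t≢u q
      disj (inj₁ (t∈T , t≢t₁ , t≢t₂)) (inj₂ (inj₁ refl)) _ q = new-triangle-disjoint good t₁∈T t₂∈T t∈T t≢t₁ t≢t₂ q
      disj (inj₁ (t∈T , t≢t₁ , t≢t₂)) (inj₂ (inj₂ refl)) _ q =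
        QuadProperties.new-triangle-disjoint (turn Q) good t₂∈T t₁∈T t∈T t≢t₂ t≢t₁ q
      disj (inj₂ (inj₁ refl)) (inj₁ (u∈T , u≢t₁ , u≢t₂)) _ q (i , j) =
        new-triangle-disjoint good t₁∈T t₂∈T u∈T u≢t₁ u≢t₂ q (j , i)
      disj (inj₂ (inj₂ refl)) (inj₁ (u∈T , u≢t₁ , u≢t₂)) _ q (i , j) =
        QuadProperties.new-triangle-disjoint (turn Q) good t₂∈T t₁∈T u∈T u≢t₂ u≢t₁ q (j , i)
      disj (inj₂ (inj₁ refl)) (inj₂ (inj₁ refl)) t≢u q = ⊥-elim (t≢u refl)
      disj (inj₂ (inj₁ refl)) (inj₂ (inj₂ refl)) _ q = new-triangles-disjoint q
      disj (inj₂ (inj₂ refl)) (inj₂ (inj₁ refl)) _ q (i , j) = new-triangles-disjoint q (j , i)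
      disj (inj₂ (inj₂ refl)) (inj₂ (inj₂ refl)) t≢u q = ⊥-elim (t≢u refl)

    side-of : ∀ {T t i j k} → Good T → t ∈ T → HasVertices t i j k → LeftOf (pt k) (pt i , pt j) ⊎ LeftOf (pt k) (pt j , pt i)
    side-of {i = i} {j} {k} good t∈T h with compare 0# (orientᵢ i j k)
    ... | tri< 0<ijk _ _ = inj₁ (left 0<ijk)
    ... | tri≈ _ 0≡ijk _ = ⊥-elim (Good.nondegenerate good t∈T h (sym 0≡ijk))
    ... | tri> _ _ ijk<0 = inj₂ (left-swap (pt k) (pt i) (pt j) ijk<0)

    -- By nondegeneracy, a triangle at `x y` lies on one of the two sides of that edge, and `t₁` and
    -- `t₂` already occupy one side each.
    diagonal-triangles : ∀ {T t} → Good T → t₁ ∈ T → t₂ ∈ T → t ∈ T → VertexOf x t → VertexOf y t → t ≡ t₁ ⊎ t ≡ t₂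
    diagonal-triangles {t = t} good t₁∈T t₂∈T t∈T xt yt with third-vertex {t} x≢y xt yt
    ... | k , h with side-of {t = t} good t∈T h
    ... | inj₁ xyk = inj₁ (same-side-unique good t∈T t₁∈T h t₁-xyz xyk (xyz C))
    ... | inj₂ yxk = inj₂ (same-side-unique good t∈T t₂∈T (flip-labels {t} h) (flip-labels {t₂} t₂-xyw) yxk (yxw C))

    -- Otherwise u₁ would itself be in T, and overlap t₁ next to the edge xz.
    no-triangle-beyond : ∀ {T t k} → Good T → t₁ ∈ T → t₂ ∈ T → t ∈ T → HasVertices t z w k → ¬ LeftOf (pt k) (pt w , pt z)
    no-triangle-beyond {T} {t} good t₁∈T t₂∈T t∈T h wzk with fire
      where
      fire : ∃[ U ] Fired T t₁ t₂ u₁ u₂ U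
      fire = u₁ ∷ u₂ ∷ filter (λ t → ¬? (t ≟ᵗ t₁) ×-dec ¬? (t ≟ᵗ t₂)) T , λ t → mk⇔
        (λ { (here e) → inj₂ (inj₁ e) ; (there (here e)) → inj₂ (inj₂ e)
           ; (there (there t∈)) → inj₁ (∈-filter⁻ (λ t → ¬? (t ≟ᵗ t₁) ×-dec ¬? (t ≟ᵗ t₂)) t∈) })
        (λ { (inj₁ (t∈T , ≢)) → there (there (∈-filter⁺ (λ t → ¬? (t ≟ᵗ t₁) ×-dec ¬? (t ≟ᵗ t₂)) t∈T ≢))
           ; (inj₂ (inj₁ e)) → here e ; (inj₂ (inj₂ e)) → there (here e) })
    ... | U , fired = u₁≢t₁ (same-side-unique good u₁∈T t₁∈T zxw zxy xw-side xy-side)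
      where
      t≢t₁ : t ≢ t₁
      t≢t₁ refl = not-vertex t₁ t₁-xyz (x≢w ∘ sym) w≢y w≢z (label₂ {t} h)
      t≢t₂ : t ≢ t₂
      t≢t₂ refl = not-vertex t₂ t₂-xyw z≢x (y≢z ∘ sym) (w≢z ∘ sym) (label₁ {t} h)
      t≡u₁ : t ≡ u₁
      t≡u₁ = same-side-unique (fired-good good t₁∈T t₂∈T fired)
        (Equivalence.from (fired t) (inj₁ (t∈T , t≢t₁ , t≢t₂))) (Equivalence.from (fired u₁) (inj₂ (inj₁ refl)))
        (flip-labels {t} h) (flip-labels {u₁} u₁-zwx) wzk (wzx C)
      u₁∈T : u₁ ∈ T
      u₁∈T = subst (_∈ T) t≡u₁ t∈T
      zxw : HasVertices u₁ z x w
      zxw = flip-labels {u₁} (rotate-labels {u₁} (rotate-labels {u₁} u₁-zwx))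
      zxy : HasVertices t₁ z x y
      zxy = rotate-labels {t₁} (rotate-labels {t₁} t₁-xyz)
      xw-side : LeftOf (pt w) (pt z , pt x)
      xw-side = left-rotate (wzx C)
      xy-side : LeftOf (pt y) (pt z , pt x)
      xy-side = left-rotate (left-rotate (xyz C))

  no-new-diagonal : ∀ {x y z w T t} (Q : Quad x y z w) → Good T → Quad.t₁ Q ∈ T → Quad.t₂ Q ∈ T → t ∈ T →
                    VertexOf z t → VertexOf w t → ⊥
  no-new-diagonal {t = t} Q good t₁∈T t₂∈T t∈T zt wt with third-vertex {t} (QuadProperties.w≢z Q ∘ sym) zt wt
  ... | k , h with side-of Q {t = t} good t∈T h
  ... | inj₁ zwk = no-triangle-beyond (turn Q) good t₂∈T t₁∈T t∈T (flip-labels {t} h) zwk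
  ... | inj₂ wzk = no-triangle-beyond Q good t₁∈T t₂∈T t∈T h wzk

  -- Does not mention a triangulation: it fixes the four triangles of a flip, so that the flip keeps
  -- its tokens when it is performed at another moment. `Fires` then relates it to a current
  -- triangulation.
  record FlipQuad (f : Flip) : Set where
    field
      z w   : Fin n
      quad  : Quad (a (ε f)) (b (ε f)) z w
      φ-ends : EndsAt (φ f) z w
    open Quad quad public

  Consumed Produced : ∀ {f} → FlipQuad f → List Triangle
  Consumed q = FlipQuad.t₁ q ∷ FlipQuad.t₂ q ∷ []
  Produced q = FlipQuad.u₁ q ∷ FlipQuad.u₂ q ∷ []

  record Fires {f} (T : List Triangle) (q : FlipQuad f) (U : List Triangle) : Set where
    constructor fires
    field
      enabled : ∀ {t} → t ∈ Consumed q → t ∈ T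
      result  : ∀ t → (t ∈ U) ⇔ ((t ∈ T × t ∉ Consumed q) ⊎ t ∈ Produced q)

  ∈-pair : ∀ {A : Set} {x y z : A} → z ∈ x ∷ y ∷ [] → z ≡ x ⊎ z ≡ y
  ∈-pair (here e)         = inj₁ e
  ∈-pair (there (here e)) = inj₂ e

  pair-∈ : ∀ {A : Set} {x y z : A} → z ≡ x ⊎ z ≡ y → z ∈ x ∷ y ∷ []
  pair-∈ (inj₁ e) = here e
  pair-∈ (inj₂ e) = there (here e)

  step⇒fires : ∀ {T f U} → Step T f U → Σ (FlipQuad f) λ q → Fires T q U
  step⇒fires {T} {f} {U} (t₁ , t₂ , c , d , t₁∈T , t₂∈T , _ , h₁ , h₂ , ends , cross , result) with crossing⇒convex cross
  ... | inj₁ C = q , fires (λ t∈ → [ (λ { refl → t₁∈T }) , (λ { refl → t₂∈T }) ]′ (∈-pair t∈)) λ t → mk⇔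
        (λ t∈U → [ (λ (t∈T , ≢₁ , ≢₂) → inj₁ (t∈T , λ t∈ → [ ≢₁ , ≢₂ ]′ (∈-pair t∈)))
                 , inj₂ ∘ pair-∈ ∘ Sum.map (λ h → labels-injective {t} h c-d-a) (λ h → labels-injective {t} h c-d-b) ]′
                   (Equivalence.to (result t) t∈U))
        (λ new → Equivalence.from (result t)
          ([ (λ (t∈T , t∉) → inj₁ (t∈T , (λ e → t∉ (pair-∈ (inj₁ e))) , (λ e → t∉ (pair-∈ (inj₂ e)))))
           , inj₂ ∘ Sum.map (λ { refl → c-d-a }) (λ { refl → c-d-b }) ∘ ∈-pair ]′ new))
    where
    distinct-a = left-distinct (wzx C)
    distinct-b = left-distinct (zwy C)
    new-a = triangle-with c d (a (ε f)) (proj₁ distinct-a ∘ sym) (proj₂ (proj₂ distinct-a) ∘ sym) (proj₁ (proj₂ distinct-a) ∘ sym)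
    new-b = triangle-with c d (b (ε f)) (proj₁ distinct-b) (proj₁ (proj₂ distinct-b)) (proj₂ (proj₂ distinct-b))
    c-d-a = proj₂ new-a
    c-d-b = proj₂ new-b
    q : FlipQuad f
    q = record { z = c ; w = d ; φ-ends = ends ; quad = record
      { t₁ = t₁ ; t₂ = t₂ ; u₁ = proj₁ new-a ; u₂ = proj₁ new-b ; t₁-xyz = h₁ ; t₂-xyw = h₂
      ; u₁-zwx = c-d-a ; u₂-zwy = c-d-b ; is-convex = C } }
  -- The apexes `c` and `d` lie on the opposite sides here, so they are exchanged together with the
  -- two consumed triangles.
  ... | inj₂ C = q , fires (λ t∈ → [ (λ { refl → t₂∈T }) , (λ { refl → t₁∈T }) ]′ (∈-pair t∈)) λ t → mk⇔
        (λ t∈U → [ (λ (t∈T , ≢₁ , ≢₂) → inj₁ (t∈T , λ t∈ → [ ≢₂ , ≢₁ ]′ (∈-pair t∈)))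
                 , inj₂ ∘ pair-∈ ∘ Sum.map (λ h → labels-injective {t} (flip-labels {t} h) d-c-a)
                                           (λ h → labels-injective {t} (flip-labels {t} h) d-c-b) ]′
                   (Equivalence.to (result t) t∈U))
        (λ new → Equivalence.from (result t)
          ([ (λ (t∈T , t∉) → inj₁ (t∈T , (λ e → t∉ (pair-∈ (inj₂ e))) , (λ e → t∉ (pair-∈ (inj₁ e)))))
           , inj₂ ∘ Sum.map (λ { refl → flip-labels {t} d-c-a }) (λ { refl → flip-labels {t} d-c-b }) ∘ ∈-pair ]′ new))
    where
    distinct-a = left-distinct (wzx C)
    distinct-b = left-distinct (zwy C)
    new-a = triangle-with d c (a (ε f)) (proj₁ distinct-a ∘ sym) (proj₂ (proj₂ distinct-a) ∘ sym) (proj₁ (proj₂ distinct-a) ∘ sym)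
    new-b = triangle-with d c (b (ε f)) (proj₁ distinct-b) (proj₁ (proj₂ distinct-b)) (proj₂ (proj₂ distinct-b))
    d-c-a = proj₂ new-a
    d-c-b = proj₂ new-b
    q : FlipQuad f
    q = record { z = d ; w = c ; φ-ends = swap ends ; quad = record
      { t₁ = t₂ ; t₂ = t₁ ; u₁ = proj₁ new-a ; u₂ = proj₁ new-b ; t₁-xyz = h₂ ; t₂-xyw = h₁
      ; u₁-zwx = d-c-a ; u₂-zwy = d-c-b ; is-convex = C } }

  module FlipProperties {f : Flip} (q : FlipQuad f) where
    open FlipQuad q
    open QuadProperties quad

    fires⇒step : ∀ {T U} → Fires T q U → Step T f U
    fires⇒step (fires enabled result) =
      t₁ , t₂ , z , w , enabled (here refl) , enabled (there (here refl)) , t₁≢t₂ , t₁-xyz , t₂-xyw , φ-ends ,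
      convex⇒crossing is-convex , λ t → mk⇔
        (λ t∈U → [ (λ (t∈T , t∉) → inj₁ (t∈T , (λ e → t∉ (pair-∈ (inj₁ e))) , (λ e → t∉ (pair-∈ (inj₂ e)))))
                 , inj₂ ∘ Sum.map (λ { refl → u₁-zwx }) (λ { refl → u₂-zwy }) ∘ ∈-pair ]′ (Equivalence.to (result t) t∈U))
        (λ new → Equivalence.from (result t)
          ([ (λ (t∈T , ≢₁ , ≢₂) → inj₁ (t∈T , λ t∈ → [ ≢₁ , ≢₂ ]′ (∈-pair t∈)))
           , inj₂ ∘ pair-∈ ∘ Sum.map (λ h → labels-injective {t} h u₁-zwx) (λ h → labels-injective {t} h u₂-zwy) ]′ new))

    fires⇒good : ∀ {T U} → Good T → Fires T q U → Good U
    fires⇒good good (fires enabled result) =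
      fired-good quad good (enabled (here refl)) (enabled (there (here refl))) λ t → mk⇔
        (λ t∈U → Sum.map (λ (t∈T , t∉) → t∈T , (λ e → t∉ (pair-∈ (inj₁ e))) , (λ e → t∉ (pair-∈ (inj₂ e)))) ∈-pair
                   (Equivalence.to (result t) t∈U))
        (λ new → Equivalence.from (result t)
          (Sum.map (λ (t∈T , ≢₁ , ≢₂) → t∈T , λ t∈ → [ ≢₁ , ≢₂ ]′ (∈-pair t∈)) pair-∈ new))

    ε-consumed : ∀ {t} → t ∈ Consumed q → EdgeOf (ε f) t
    ε-consumed (here refl)         = label₁ {t₁} t₁-xyz , label₂ {t₁} t₁-xyz
    ε-consumed (there (here refl)) = label₁ {t₂} t₂-xyw , label₂ {t₂} t₂-xyw

    φ-produced : ∀ {t} → t ∈ Produced q → EdgeOf (φ f) t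
    φ-produced (here refl)         = ends-edgeOf {φ f} {t = u₁} φ-ends (label₁ {u₁} u₁-zwx) (label₂ {u₁} u₁-zwx)
    φ-produced (there (here refl)) = ends-edgeOf {φ f} {t = u₂} φ-ends (label₁ {u₂} u₂-zwy) (label₂ {u₂} u₂-zwy)

    ε-not-produced : ∀ {t} → t ∈ Produced q → ¬ EdgeOf (ε f) t
    ε-not-produced (here refl) (_ , v)         = not-vertex u₁ u₁-zwx y≢z (w≢y ∘ sym) (x≢y ∘ sym) v
    ε-not-produced (there (here refl)) (v , _) = not-vertex u₂ u₂-zwy (z≢x ∘ sym) x≢w x≢y v

    consumed-only : ∀ {T t} → Good T → (∀ {t} → t ∈ Consumed q → t ∈ T) → t ∈ T → EdgeOf (ε f) t → t ∈ Consumed q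
    consumed-only {t = t} good enabled t∈T (v , v′) =
      pair-∈ (diagonal-triangles quad {t = t} good (enabled (here refl)) (enabled (there (here refl))) t∈T v v′)

    φ-new : ∀ {T t} → Good T → (∀ {t} → t ∈ Consumed q → t ∈ T) → t ∈ T → ¬ EdgeOf (φ f) t
    φ-new {t = t} good enabled t∈T φ∈t = let zt , wt = edgeOf-ends {φ f} {t = t} φ-ends φ∈t in
      no-new-diagonal {t = t} quad good (enabled (here refl)) (enabled (there (here refl))) t∈T zt wt

    private
      ε-ends : EndsAt (ε f) (a (ε f)) (b (ε f))
      ε-ends = inj₁ (refl , refl)

    -- Each of the four sides of the quadrilateral lies in one old and one new triangle;
    -- `boundary-old` is the reverse passage.
    boundary-kept : ∀ {g t} → t ∈ Consumed q → EdgeOf g t → g ≢ ε f → ∃[ u ] (u ∈ Produced q × EdgeOf g u)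
    boundary-kept {g} (here refl) g∈t g≢ε with other-edge {ε f} {g} {t₁} ε-ends t₁-xyz g∈t g≢ε
    ... | inj₁ ends = u₁ , here refl , ends-edgeOf {g} {t = u₁} ends (label₁ {u₁} u₁-zwx) (label₃ {u₁} u₁-zwx)
    ... | inj₂ ends = u₂ , there (here refl) , ends-edgeOf {g} {t = u₂} ends (label₁ {u₂} u₂-zwy) (label₃ {u₂} u₂-zwy)
    boundary-kept {g} (there (here refl)) g∈t g≢ε with other-edge {ε f} {g} {t₂} ε-ends t₂-xyw g∈t g≢ε
    ... | inj₁ ends = u₁ , here refl , ends-edgeOf {g} {t = u₁} ends (label₂ {u₁} u₁-zwx) (label₃ {u₁} u₁-zwx)
    ... | inj₂ ends = u₂ , there (here refl) , ends-edgeOf {g} {t = u₂} ends (label₂ {u₂} u₂-zwy) (label₃ {u₂} u₂-zwy)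

    boundary-old : ∀ {g u} → u ∈ Produced q → EdgeOf g u → g ≢ φ f → ∃[ t ] (t ∈ Consumed q × EdgeOf g t)
    boundary-old {g} (here refl) g∈u g≢φ with other-edge {φ f} {g} {u₁} φ-ends u₁-zwx g∈u g≢φ
    ... | inj₁ ends = t₁ , here refl , ends-edgeOf {g} {t = t₁} ends (label₁ {t₁} t₁-xyz) (label₃ {t₁} t₁-xyz)
    ... | inj₂ ends = t₂ , there (here refl) , ends-edgeOf {g} {t = t₂} ends (label₁ {t₂} t₂-xyw) (label₃ {t₂} t₂-xyw)
    boundary-old {g} (there (here refl)) g∈u g≢φ with other-edge {φ f} {g} {u₂} φ-ends u₂-zwy g∈u g≢φ
    ... | inj₁ ends = t₁ , here refl , ends-edgeOf {g} {t = t₁} ends (label₂ {t₁} t₁-xyz) (label₃ {t₁} t₁-xyz)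
    ... | inj₂ ends = t₂ , there (here refl) , ends-edgeOf {g} {t = t₂} ends (label₂ {t₂} t₂-xyw) (label₃ {t₂} t₂-xyw)

    -- The side `z x` serves as witness. It gives the agent somewhere to go after a flip when no
    -- destination is prescribed.
    boundary-edge : ∃[ g ] ∃[ t ] ∃[ u ] (t ∈ Consumed q × EdgeOf g t × g ≢ ε f × u ∈ Produced q × EdgeOf g u × g ≢ φ f)
    boundary-edge with edge-between z≢x
    ... | g , ends = g , t₁ , u₁ ,
      here refl , ends-edgeOf {g} {t = t₁} ends (label₃ {t₁} t₁-xyz) (label₁ {t₁} t₁-xyz) , g≢ε ,
      here refl , ends-edgeOf {g} {t = u₁} ends (label₁ {u₁} u₁-zwx) (label₃ {u₁} u₁-zwx) , g≢φ
      where
      g≢ε : g ≢ ε f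
      g≢ε refl = not-vertex u₁ u₁-zwx y≢z (w≢y ∘ sym) (x≢y ∘ sym)
        (proj₂ (ends-edgeOf {g} {t = u₁} ends (label₁ {u₁} u₁-zwx) (label₃ {u₁} u₁-zwx)))
      g≢φ : g ≢ φ f
      g≢φ refl = not-vertex t₁ t₁-xyz (x≢w ∘ sym) w≢y w≢z
        (proj₂ (edgeOf-ends {φ f} {t = t₁} φ-ends (ends-edgeOf {g} {t = t₁} ends (label₃ {t₁} t₁-xyz) (label₁ {t₁} t₁-xyz))))

-- The Petri net of a flip sequence: firing, commuting and splitting.

module Firing (K : OrderedField) (n : ℕ) (pt : Fin n → Geometry.Point K) where
  open Geometry.PointSet K n pt
  open TriangleProperties K n pt

  module Sequence (k : ℕ) (F : Fin k → Flip) (quads : ∀ x → FlipQuad (F x)) where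

    ins outs tokens : Fin k → List Triangle
    ins x    = Consumed (quads x)
    outs x   = Produced (quads x)
    tokens x = ins x ++ outs x

    Dependent : Fin k → Fin k → Set
    Dependent x y = ∃[ t ] (t ∈ tokens x × t ∈ tokens y)

    _∈?_ : ∀ t T → Dec (t ∈ T)
    t ∈? T = any? (t ≟ᵗ_) T

    _∈ᵢ?_ : ∀ (x : Fin k) L → Dec (x ∈ L)
    x ∈ᵢ? L = any? (x Fin.≟_) L

    dependent? : ∀ x y → Dec (Dependent x y)
    dependent? x y = map′ (λ p → let t , p , q = find p in t , p , q) (λ (t , p , q) → lose p q)
      (any? (_∈? tokens y) (tokens x))

    dependent-sym : ∀ {x y} → Dependent x y → Dependent y x
    dependent-sym (t , p , q) = t , q , p

    out-in : ∀ {x y t} → t ∈ outs x → t ∈ ins y → Dependent x y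
    out-in {x} o i = _ , ∈-++⁺ʳ (ins x) o , ∈-++⁺ˡ i

    in-in : ∀ {x y t} → t ∈ ins x → t ∈ ins y → Dependent x y
    in-in i j = _ , ∈-++⁺ˡ i , ∈-++⁺ˡ j

    Fire : List Triangle → Fin k → List Triangle → Set
    Fire T x U = Fires T (quads x) U

    Enabled : List Triangle → Fin k → Set
    Enabled T x = ∀ {t} → t ∈ ins x → t ∈ T

    after⁻ : ∀ {T x U t} → Fire T x U → t ∈ U → (t ∈ T × t ∉ ins x) ⊎ t ∈ outs x
    after⁻ f = Equivalence.to (Fires.result f _)

    kept : ∀ {T x U t} → Fire T x U → t ∈ T → t ∉ ins x → t ∈ U
    kept f t∈T t∉ = Equivalence.from (Fires.result f _) (inj₁ (t∈T , t∉))

    produced : ∀ {T x U t} → Fire T x U → t ∈ outs x → t ∈ U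
    produced f o = Equivalence.from (Fires.result f _) (inj₂ o)

    fire : ∀ {T x} → Enabled T x → ∃[ U ] Fire T x U
    fire {T} {x} enabled = outs x ++ filter (λ t → ¬? (t ∈? ins x)) T , fires enabled λ t → mk⇔
      (λ t∈ → [ inj₂ , inj₁ ∘ ∈-filter⁻ (λ t → ¬? (t ∈? ins x)) ]′ (∈-++⁻ (outs x) t∈))
      [ (λ (t∈T , t∉) → ∈-++⁺ʳ (outs x) (∈-filter⁺ (λ t → ¬? (t ∈? ins x)) t∈T t∉)) , ∈-++⁺ˡ ]′

    fire-good : ∀ {T x U} → Good T → Fire T x U → Good U
    fire-good {x = x} = FlipProperties.fires⇒good (quads x)

    -- A produced triangle contains the new diagonal, which lies in no triangle of `T`.
    outs-new : ∀ {T x t} → Good T → Enabled T x → t ∈ outs x → t ∉ T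
    outs-new {x = x} {t} good enabled o t∈T =
      FlipProperties.φ-new (quads x) {t = t} good enabled t∈T (FlipProperties.φ-produced (quads x) o)

    _≈_ : List Triangle → List Triangle → Set
    _≈_ = SameTriangles

    ≈-refl : ∀ {T} → T ≈ T
    ≈-refl t = mk⇔ id id

    fire-≈ : ∀ {T x U V} → Fire T x U → U ≈ V → Fire T x V
    fire-≈ f U≈V = fires (Fires.enabled f) λ t → mk⇔
      (after⁻ f ∘ Equivalence.from (U≈V t)) (Equivalence.to (U≈V t) ∘ Equivalence.from (Fires.result f t))

    ≈-fire : ∀ {S T x U} → S ≈ T → Fire T x U → Fire S x U
    ≈-fire S≈T f = fires (Equivalence.from (S≈T _) ∘ Fires.enabled f) λ t → mk⇔
      (Sum.map₁ (λ (t∈T , t∉) → Equivalence.from (S≈T t) t∈T , t∉) ∘ after⁻ f)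
      (Equivalence.from (Fires.result f t) ∘ Sum.map₁ (λ (t∈S , t∉) → Equivalence.to (S≈T t) t∈S , t∉))

    enabled-before : ∀ {T x U y} → Fire T x U → Enabled U y → (∀ {t} → t ∈ outs x → t ∉ ins y) → Enabled T y
    enabled-before f enabled sep i = [ proj₁ , (λ o → ⊥-elim (sep o i)) ]′ (after⁻ f (enabled i))

    -- For neighbours, causal separation already excludes every shared triangle. If `y` uses nothing
    -- from `x`, it was enabled before `x`, so by `outs-new` what it produces is absent from both
    -- `T` and `U`, whereas the tokens of `x` all occur in one of these.
    consecutive-independent : ∀ {T x U y} → Good T → Fire T x U → Enabled U y →
                              (∀ {t} → t ∈ outs x → t ∉ ins y) → ¬ Dependent x y
    consecutive-independent {T} {x} {U} {y} good f enabled sep (t , p , q) = cases (∈-++⁻ (ins x) p) (∈-++⁻ (ins y) q)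
      where
      cases : t ∈ ins x ⊎ t ∈ outs x → t ∈ ins y ⊎ t ∈ outs y → ⊥
      cases (inj₁ i) (inj₁ j) = [ (λ (_ , t∉) → t∉ i) , (λ o → sep o j) ]′ (after⁻ f (enabled j))
      cases (inj₂ o) (inj₁ j) = sep o j
      cases (inj₁ i) (inj₂ o) = outs-new {x = y} good (enabled-before f enabled sep) o (Fires.enabled f i)
      cases (inj₂ o) (inj₂ o′) = outs-new {x = y} (fire-good good f) enabled o′ (produced f o)

    swap-fires : ∀ {T x U y V} → Fire T x U → Fire U y V → ¬ Dependent x y → ∃[ U′ ] (Fire T y U′ × Fire U′ x V)
    swap-fires {T} {x} {U} {y} {V} f g indep = U′ , f′ , fires (λ i → kept f′ (Fires.enabled f i) λ j → indep (in-in i j))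
        λ t → mk⇔ (to t) (from t)
      where
      sep : ∀ {t} → t ∈ outs x → t ∉ ins y
      sep o i = indep (out-in o i)
      U′ = proj₁ (fire (enabled-before f (Fires.enabled g) sep))
      f′ = proj₂ (fire (enabled-before f (Fires.enabled g) sep))
      to : ∀ t → t ∈ V → (t ∈ U′ × t ∉ ins x) ⊎ t ∈ outs x
      to t t∈V with after⁻ g t∈V
      ... | inj₂ o = inj₁ (produced f′ o , λ i → indep (t , ∈-++⁺ˡ i , ∈-++⁺ʳ (ins y) o))
      ... | inj₁ (t∈U , t∉y) with after⁻ f t∈U
      ...   | inj₂ o = inj₂ o
      ...   | inj₁ (t∈T , t∉x) = inj₁ (kept f′ t∈T t∉y , t∉x)
      from : ∀ t → (t ∈ U′ × t ∉ ins x) ⊎ t ∈ outs x → t ∈ V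
      from t (inj₂ o) = kept g (produced f o) (sep o)
      from t (inj₁ (t∈U′ , t∉x)) with after⁻ f′ t∈U′
      ... | inj₂ o = produced g o
      ... | inj₁ (t∈T , t∉y) = kept g (kept f t∈T t∉x) t∉y

    data Play : List Triangle → List (Fin k) → List Triangle → Set where
      done : ∀ {T U} → T ≈ U → Play T [] U
      _▸_  : ∀ {T x U L V} → Fire T x U → Play U L V → Play T (x ∷ L) V

    ≈-play : ∀ {S T L U} → S ≈ T → Play T L U → Play S L U
    ≈-play S≈T (done T≈U) = done λ t → mk⇔ (Equivalence.to (T≈U t) ∘ Equivalence.to (S≈T t))
                                           (Equivalence.from (S≈T t) ∘ Equivalence.from (T≈U t))
    ≈-play S≈T (f ▸ p) = ≈-fire S≈T f ▸ p

    play-good : ∀ {T L U} → Good T → Play T L U → Good U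
    play-good good (done T≈U) = record
      { nondegenerate = Good.nondegenerate good ∘ Equivalence.from (T≈U _)
      ; disjoint = λ t∈ u∈ → Good.disjoint good (Equivalence.from (T≈U _) t∈) (Equivalence.from (T≈U _) u∈) }
    play-good good (f ▸ p) = play-good (fire-good good f) p

    postpone : ∀ {T x U A V} → Fire T x U → Play U A V → (∀ {y} → y ∈ A → ¬ Dependent x y) →
               ∃[ U′ ] (Play T A U′ × Fire U′ x V)
    postpone f (done U≈V) indep = _ , done ≈-refl , fire-≈ f U≈V
    postpone f (g ▸ p) indep =
      let U′ , g′ , f′ = swap-fires f g (indep (here refl))
          V′ , p′ , f″ = postpone f′ p (indep ∘ there)
      in V′ , g′ ▸ p′ , f″

    -- Split L A B: B can be postponed until A has been played.
    data Split : List (Fin k) → List (Fin k) → List (Fin k) → Set where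
      []   : Split [] [] []
      first : ∀ {x L A B} → Split L A B → Split (x ∷ L) (x ∷ A) B
      later : ∀ {x L A B} → (∀ {y} → y ∈ A → ¬ Dependent x y) → Split L A B → Split (x ∷ L) A (x ∷ B)

    split-play : ∀ {L A B T W} → Split L A B → Play T L W → ∃[ V ] (Play T A V × Play V B W)
    split-play [] p = _ , done ≈-refl , p
    split-play (first s) (f ▸ p) = let V , pA , pB = split-play s p in V , f ▸ pA , pB
    split-play (later indep s) (f ▸ p) =
      let V  , pA  , pB = split-play s p
          V′ , pA′ , f′ = postpone f pA indep
      in V′ , pA′ , f′ ▸ pB

    split-⊆ˡ : ∀ {L A B x} → Split L A B → x ∈ A → x ∈ L
    split-⊆ˡ (first s) (here e) = here e
    split-⊆ˡ (first s) (there x∈) = there (split-⊆ˡ s x∈)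
    split-⊆ˡ (later _ s) x∈ = there (split-⊆ˡ s x∈)

    split-⊆ʳ : ∀ {L A B x} → Split L A B → x ∈ B → x ∈ L
    split-⊆ʳ (first s) x∈ = there (split-⊆ʳ s x∈)
    split-⊆ʳ (later _ s) (here e) = here e
    split-⊆ʳ (later _ s) (there x∈) = there (split-⊆ʳ s x∈)

    split-∈ : ∀ {L A B x} → Split L A B → x ∈ L → x ∈ A ⊎ x ∈ B
    split-∈ (first s) (here e) = inj₁ (here e)
    split-∈ (first s) (there x∈) = Sum.map₁ there (split-∈ s x∈)
    split-∈ (later _ s) (here e) = inj₂ (here e)
    split-∈ (later _ s) (there x∈) = Sum.map₂ there (split-∈ s x∈)

    Sorted : List (Fin k) → Set
    Sorted = AllPairs Fin._<_

    split-sorted : ∀ {L A B} → Split L A B → Sorted L → Sorted A × Sorted B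
    split-sorted [] [] = [] , []
    split-sorted (first s) (x< ∷ L<) = let A< , B< = split-sorted s L< in
      All.tabulate (All.lookup x< ∘ split-⊆ˡ s) ∷ A< , B<
    split-sorted (later _ s) (x< ∷ L<) = let A< , B< = split-sorted s L< in
      A< , All.tabulate (All.lookup x< ∘ split-⊆ʳ s) ∷ B<

    split-independent : ∀ {L A B x y} → Split L A B → Sorted L → x ∈ B → y ∈ A → x Fin.< y → ¬ Dependent x y
    split-independent (first s) (z< ∷ L<) x∈B (here refl) x<y = ⊥-elim (Fin.<-asym x<y (All.lookup z< (split-⊆ʳ s x∈B)))
    split-independent (first s) (_ ∷ L<) x∈B (there y∈A) x<y = split-independent s L< x∈B y∈A x<y
    split-independent (later indep s) _ (here refl) y∈A x<y = indep y∈A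
    split-independent (later _ s) (_ ∷ L<) (there x∈B) y∈A x<y = split-independent s L< x∈B y∈A x<y

    split-disjoint : ∀ {L A B x} → Split L A B → Sorted L → x ∈ A → x ∉ B
    split-disjoint (first s) (z< ∷ _) (here refl) x∈B = Fin.<-irrefl refl (All.lookup z< (split-⊆ʳ s x∈B))
    split-disjoint (first s) (_ ∷ L<) (there x∈A) x∈B = split-disjoint s L< x∈A x∈B
    split-disjoint (later _ s) (z< ∷ _) x∈A (here refl) = Fin.<-irrefl refl (All.lookup z< (split-⊆ˡ s x∈A))
    split-disjoint (later _ s) (_ ∷ L<) x∈A (there x∈B) = split-disjoint s L< x∈A x∈B

    split-length : ∀ {L A B} → Split L A B → length L ≡ length A ℕ.+ length B
    split-length [] = refl
    split-length (first s) = cong suc (split-length s)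
    split-length {A = A} (later _ s) = trans (cong suc (split-length s)) (sym (ℕₚ.+-suc (length A) _))

    unconsumed-kept : ∀ {T L W t} → Play T L W → t ∈ T → (∀ {y} → y ∈ L → t ∉ ins y) → t ∈ W
    unconsumed-kept (done T≈W) t∈T _ = Equivalence.to (T≈W _) t∈T
    unconsumed-kept (f ▸ p) t∈T none = unconsumed-kept p (kept f t∈T (none (here refl))) (none ∘ there)

    -- The flip `x` is commuted past the list one flip at a time; at each stage the two are
    -- neighbours, where `consecutive-independent` applies.
    unused-independent : ∀ {T x U L W} → Good T → Fire T x U → Play U L W →
                         (∀ {y t} → y ∈ L → t ∈ outs x → t ∉ ins y) → ∀ {y} → y ∈ L → ¬ Dependent x y
    unused-independent good f (g ▸ p) sep (here refl) =
      consecutive-independent good f (Fires.enabled g) (sep (here refl))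
    unused-independent good f (g ▸ p) sep (there y∈L) =
      let U′ , g′ , f′ = swap-fires f g (consecutive-independent good f (Fires.enabled g) (sep (here refl)))
      in unused-independent (fire-good good g′) f′ p (sep ∘ there) y∈L

    -- Flipping an edge consumes all triangles at it, so `t` is consumed by `x` unless an earlier
    -- flip has taken it.
    flipped-consumed : ∀ {T L W x t} → Good T → Play T L W → Sorted L → t ∈ T → x ∈ L → EdgeOf (ε (F x)) t →
                       ∃[ y ] (y ∈ L × t ∈ ins y × ¬ x Fin.< y)
    flipped-consumed {t = t} good (_▸_ {x = h} f p) (h< ∷ L<) t∈T x∈L e∈t with t ∈? ins h | x∈L
    ... | yes i | here refl  = h , here refl , i , Fin.<-irrefl refl
    ... | yes i | there x∈L′ = h , here refl , i , λ x<h → Fin.<-asym x<h (All.lookup h< x∈L′)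
    ... | no ∉i | here refl  = ⊥-elim (∉i (FlipProperties.consumed-only (quads h) {t = t} good (Fires.enabled f) t∈T e∈t))
    ... | no ∉i | there x∈L′ = let y , y∈ , i , x≮y = flipped-consumed (fire-good good f) p L< (kept f t∈T ∉i) x∈L′ e∈t
                               in y , there y∈ , i , x≮y

    head-least : ∀ {h L x} → Sorted (h ∷ L) → x ∈ h ∷ L → ¬ x Fin.< h
    head-least _ (here refl) = Fin.<-irrefl refl
    head-least (h< ∷ _) (there x∈) x<h = Fin.<-asym x<h (All.lookup h< x∈)

    -- First consumers, chains and sources.

    FirstConsumer : List (Fin k) → Triangle → Fin k → Set
    FirstConsumer L t p = p ∈ L × t ∈ ins p × (∀ {x} → x ∈ L → x Fin.< p → t ∉ ins x)

    least : ∀ {P : Fin k → Set} → (∀ x → Dec (P x)) → ∀ {L y} → Sorted L → y ∈ L → P y →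
            ∃[ p ] (p ∈ L × P p × (∀ {x} → x ∈ L → x Fin.< p → ¬ P x))
    least P? {h ∷ L} s y∈L Py with P? h | y∈L
    ... | yes Ph | _ = h , here refl , Ph , λ x∈ x<h → ⊥-elim (head-least s x∈ x<h)
    ... | no ¬Ph | here refl = ⊥-elim (¬Ph Py)
    least P? (_ ∷ L<) y∈L Py | no ¬Ph | there y∈L′ = let p , p∈ , Pp , min = least P? L< y∈L′ Py in
          p , there p∈ , Pp , λ { (here refl) _ → ¬Ph ; (there x∈) → min x∈ }

    first-consumer : ∀ {L t y} → Sorted L → y ∈ L → t ∈ ins y → ∃[ p ] FirstConsumer L t p
    first-consumer {t = t} = least (λ x → t ∈? ins x)

    Link : List (Fin k) → Fin k → Fin k → Set
    Link L x y = x Fin.< y × Dependent x y × x ∈ L × y ∈ L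

    Chain : List (Fin k) → Fin k → Fin k → Set
    Chain L = Star (Link L)

    chain-⊆ : ∀ {L L′ x y} → (∀ {z} → z ∈ L → z ∈ L′) → Chain L x y → Chain L′ x y
    chain-⊆ L⊆L′ = Star.map λ (lt , d , x∈ , y∈) → lt , d , L⊆L′ x∈ , L⊆L′ y∈

    chain-≤ : ∀ {L x y} → Chain L x y → x Fin.≤ y
    chain-≤ ⟨⟩ = Fin.≤-refl
    chain-≤ ((x<y , _) ◂ c) = ℕₚ.≤-trans (ℕₚ.<⇒≤ x<y) (chain-≤ c)

    FirstFlip : List (Fin k) → Fin k → Set
    FirstFlip L f = f ∈ L × (∀ {x} → x ∈ L → x Fin.< f → ε (F x) ≢ ε (F f))

    -- The triangle holding the edge passes from flip to flip until the edge itself is flipped.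
    lineage : ∀ {T L W f t} → Good T → Play T L W → Sorted L → FirstFlip L f → t ∈ T → EdgeOf (ε (F f)) t →
              ∃[ p ] (FirstConsumer L t p × Chain L p f)
    lineage {f = f} {t} good (_▸_ {x = h} g p) s@(h< ∷ L<) (f∈ , unflipped) t∈T e∈t with t ∈? ins h | f∈
    ... | yes i | here refl = h , (here refl , i , λ x∈ x<h → ⊥-elim (head-least s x∈ x<h)) , ⟨⟩
    ... | yes i | there f∈′ =
      let t′ , o , e∈t′ = FlipProperties.boundary-kept (quads h) {ε (F f)} i e∈t (unflipped (here refl) (All.lookup h< f∈′) ∘ sym)
          q , (q∈ , j , _) , c = lineage {t = t′} (fire-good good g) p L< (f∈′ , unflipped ∘ there) (produced g o) e∈t′
      in h , (here refl , i , λ x∈ x<h → ⊥-elim (head-least s x∈ x<h)) ,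
         ((All.lookup h< q∈ , out-in o j , here refl , there q∈) ◂ chain-⊆ there c)
    ... | no ∉i | here refl = ⊥-elim (∉i (FlipProperties.consumed-only (quads h) {t = t} good (Fires.enabled g) t∈T e∈t))
    ... | no ∉i | there f∈′ =
      let q , (q∈ , j , least) , c = lineage {t = t} (fire-good good g) p L< (f∈′ , unflipped ∘ there) (kept g t∈T ∉i) e∈t
      in q , (there q∈ , j , λ { (here refl) _ → ∉i ; (there x∈) → least x∈ }) , chain-⊆ there c

    undisturbed-edge : ∀ {T h U e t₀ u} → Good T → Fire T h U → (∀ {t} → t ∈ ins h → ¬ EdgeOf e t) →
                       t₀ ∈ T → EdgeOf e t₀ → u ∈ U → EdgeOf e u → u ∈ T
    undisturbed-edge {T} {h} {e = e} {t₀} {u} good g none t₀∈T e∈t₀ u∈U e∈u with after⁻ g u∈U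
    ... | inj₁ (u∈T , _) = u∈T
    ... | inj₂ o = let t′ , j , e∈t′ = FlipProperties.boundary-old (quads h) {e} {u} o e∈u e≢φ
                   in ⊥-elim (none {t′} j e∈t′)
      where
      e≢φ : e ≢ φ (F h)
      e≢φ e≡φ = FlipProperties.φ-new (quads h) {t = t₀} good (Fires.enabled g) t₀∈T (subst (λ e → EdgeOf e t₀) e≡φ e∈t₀)

    -- The triangles around an edge persist until some flip consumes one of them.
    consumed-or-present : ∀ {T L W f t t₀} → Good T → Play T L W → Sorted L → FirstFlip L f →
      t₀ ∈ T → EdgeOf (ε (F f)) t₀ → t ∈ ins f →
      t ∈ T ⊎ ∃[ x ] ∃[ t′ ] (x ∈ L × x Fin.< f × t′ ∈ ins x × t′ ∈ T × EdgeOf (ε (F f)) t′)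
    consumed-or-present good (g ▸ p) s (here refl , _) _ _ i = inj₁ (Fires.enabled g i)
    consumed-or-present {f = f} {t} {t₀} good (_▸_ {x = h} g p) (h< ∷ L<) (there f∈ , unflipped) t₀∈T e∈t₀ i
      with any? (edgeOf? (ε (F f))) (ins h)
    ... | yes some = let t′ , j , e∈t′ = find some in
          inj₂ (h , t′ , here refl , All.lookup h< f∈ , j , Fires.enabled g j , e∈t′)
    ... | no none with consumed-or-present {t₀ = t₀} (fire-good good g) p L< (f∈ , unflipped ∘ there)
                         (kept g t₀∈T (λ j → none (lose j e∈t₀))) e∈t₀ i
    ...   | inj₁ t∈U = let e∈t = FlipProperties.ε-consumed (quads f) {t} i in
            inj₁ (undisturbed-edge {e = ε (F f)} {t₀} {t} good g (λ j e∈ → none (lose j e∈)) t₀∈T e∈t₀ t∈U e∈t)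
    ...   | inj₂ (x , t′ , x∈ , x<f , j , t′∈U , e∈t′) =
            inj₂ (x , t′ , there x∈ , x<f , j ,
                  undisturbed-edge {e = ε (F f)} {t₀} {t′} good g (λ j e∈ → none (lose j e∈)) t₀∈T e∈t₀ t′∈U e∈t′ , e∈t′)

    IsSource : List (Fin k) → Fin k → List (Fin k) → Set
    IsSource L f L′ = Split L (f ∷ []) L′

    split-none : ∀ L → Split L [] L
    split-none []      = []
    split-none (x ∷ L) = later (λ ()) (split-none L)

    -- The triangles `f` needs are present and stay untouched. An earlier flip cannot produce one of
    -- them either, since produced triangles are new; hence `f` commutes with everything before it.
    unthreatened-source : ∀ {T L W f} → Good T → Play T L W → Sorted L → f ∈ L → Enabled T f →
      (∀ {x t} → x ∈ L → x Fin.< f → t ∈ ins f → t ∉ ins x) → ∃[ L′ ] IsSource L f L′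
    unthreatened-source {L = _ ∷ L} good (g ▸ p) s (here refl) enabled safe = L , first (split-none L)
    unthreatened-source {L = h ∷ L} {f = f} good (g ▸ p) (h< ∷ L<) (there f∈) enabled safe =
      let L′ , s = unthreatened-source (fire-good good g) p L< f∈ enabledU (safe ∘ there)
      in h ∷ L′ , later (λ { (here refl) → consecutive-independent good g enabledU sep }) s
      where
      enabledU : Enabled _ f
      enabledU i = kept g (enabled i) (safe (here refl) (All.lookup h< f∈) i)
      sep : ∀ {t} → t ∈ outs h → t ∉ ins f
      sep o i = outs-new {x = h} good (Fires.enabled g) o (enabled i)

    Present : List Triangle → Fin k → Set
    Present T f = ∃[ t ] (t ∈ T × EdgeOf (ε (F f)) t)

    -- A threat is a flip before `f` that consumes a present triangle at the edge of `f`. The agent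
    -- can step to its edge at once, because the two edges share that triangle.
    source-or-threat : ∀ {T L W f} → Good T → Play T L W → Sorted L → FirstFlip L f → Present T f →
      (∃[ L′ ] IsSource L f L′) ⊎ ∃[ p ] ∃[ t ] (p Fin.< f × t ∈ T × EdgeOf (ε (F f)) t × FirstConsumer L t p × Chain L p f)
    source-or-threat {T} {L} {W} {f} good p s ff@(f∈ , _) (t₀ , t₀∈T , e∈t₀)
      with any? (λ x → (x Fin.<? f) ×-dec any? (λ t → (t ∈? T) ×-dec edgeOf? (ε (F f)) t) (ins x)) L
    ... | yes threat =
      let x , x∈ , x<f , r = find threat
          t , i , t∈T , e∈t = find r
          q , (q∈ , j , least) , c = lineage {t = t} good p s ff t∈T e∈t
      -- The threat `x` that was found need not be the first consumer of `t`; the first one `q` is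
      -- no later than `x`, hence also precedes `f`.
      in inj₂ (q , t , ℕₚ.≤-<-trans (ℕₚ.≮⇒≥ λ x<q → least x∈ x<q i) x<f , t∈T , e∈t , (q∈ , j , least) , c)
    ... | no safe = inj₁ (unthreatened-source good p s f∈ enabled
                     λ x∈ x<f i j → safe (lose x∈ (x<f , lose j (enabled i , FlipProperties.ε-consumed (quads f) i))))
      where
      enabled : Enabled T f
      enabled {t} i with consumed-or-present {t₀ = t₀} good p s ff t₀∈T e∈t₀ i
      ... | inj₁ t∈T = t∈T
      ... | inj₂ (x , t′ , x∈ , x<f , j , t′∈T , e∈t′) = ⊥-elim (safe (lose x∈ (x<f , lose j (t′∈T , e∈t′))))

    -- An earlier flip of the same edge, which is an edge of `t`, would have required `t` to be
    -- consumed by then.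
    first-consumer-flips-first : ∀ {T L W t p} → Good T → Play T L W → Sorted L → t ∈ T → FirstConsumer L t p → FirstFlip L p
    first-consumer-flips-first {L = L} {t = t} {p} good play s t∈T (p∈ , i , least) = p∈ , λ {x} x∈ x<p εx≡εp →
      let y , y∈ , j , x≮y = flipped-consumed {x = x} {t = t} good play s t∈T x∈
                               (subst (λ e → EdgeOf e t) (sym εx≡εp) (FlipProperties.ε-consumed (quads p) i))
      in least y∈ (ℕₚ.≤-<-trans (ℕₚ.≮⇒≥ x≮y) x<p) j

    first-flip-⊆ : ∀ {L L′ f} → (∀ {x} → x ∈ L′ → x ∈ L) → f ∈ L′ → FirstFlip L f → FirstFlip L′ f
    first-flip-⊆ L′⊆L f∈ (_ , unflipped) = f∈ , unflipped ∘ L′⊆L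

    -- A postponed flip has no later dependent flip in `A`, so an ascending chain that starts in `B`
    -- never leaves it.
    chain-later : ∀ {L A B x y} → Split L A B → Sorted L → x ∈ B → Chain L x y → Chain B x y
    chain-later s L< x∈B ⟨⟩ = ⟨⟩
    chain-later s L< x∈B ((x<z , d , _ , z∈) ◂ c) with split-∈ s z∈
    ... | inj₁ z∈A = ⊥-elim (split-independent s L< x∈B z∈A x<z d)
    ... | inj₂ z∈B = (x<z , d , x∈B , z∈B) ◂ chain-later s L< z∈B c

    chain-end : ∀ {L x y} → x ∈ L → Chain L x y → y ∈ L
    chain-end x∈ ⟨⟩ = x∈
    chain-end x∈ ((_ , _ , _ , z∈) ◂ c) = chain-end z∈ c

    -- Connectedness

    Adjacent : List (Fin k) → Fin k → Fin k → Set
    Adjacent L x y = Dependent x y × x ∈ L × y ∈ L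

    Path : List (Fin k) → Fin k → Fin k → Set
    Path L = Star (Adjacent L)

    Connected : List (Fin k) → Set
    Connected L = ∀ {x y} → x ∈ L → y ∈ L → Path L x y

    path-⊆ : ∀ {L L′ x y} → (∀ {z} → z ∈ L → z ∈ L′) → Path L x y → Path L′ x y
    path-⊆ L⊆L′ = Star.map λ (d , x∈ , y∈) → d , L⊆L′ x∈ , L⊆L′ y∈

    path-sym : ∀ {L x y} → Path L x y → Path L y x
    path-sym = Star.reverse λ (d , x∈ , y∈) → dependent-sym d , y∈ , x∈

    chain⇒path : ∀ {L x y} → Chain L x y → Path L x y
    chain⇒path = Star.map λ (_ , r) → r

    Independent : List (Fin k) → List (Fin k) → Set
    Independent A B = ∀ {x y} → x ∈ A → y ∈ B → ¬ Dependent x y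

    independent-split : ∀ {L A B} → Interleaving A B L → Independent B A → Split L A B
    independent-split [] _ = []
    independent-split (consˡ i) indep = first (independent-split i λ x∈ y∈ → indep x∈ (there y∈))
    independent-split (consʳ i) indep = later (indep (here refl)) (independent-split i λ x∈ → indep (there x∈))

    interleaving-∈ : ∀ {L A B : List (Fin k)} {x} → Interleaving A B L → x ∈ L → x ∈ A ⊎ x ∈ B
    interleaving-∈ (consˡ i) (here e) = inj₁ (here e)
    interleaving-∈ (consʳ i) (here e) = inj₂ (here e)
    interleaving-∈ (consˡ i) (there x∈) = Sum.map₁ there (interleaving-∈ i x∈)
    interleaving-∈ (consʳ i) (there x∈) = Sum.map₂ there (interleaving-∈ i x∈)

    interleaving-⊆ˡ : ∀ {L A B : List (Fin k)} {x} → Interleaving A B L → x ∈ A → x ∈ L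
    interleaving-⊆ˡ (consˡ i) (here e) = here e
    interleaving-⊆ˡ (consˡ i) (there x∈) = there (interleaving-⊆ˡ i x∈)
    interleaving-⊆ˡ (consʳ i) x∈ = there (interleaving-⊆ˡ i x∈)

    interleaving-⊆ʳ : ∀ {L A B : List (Fin k)} {x} → Interleaving A B L → x ∈ B → x ∈ L
    interleaving-⊆ʳ i = interleaving-⊆ˡ (Interleaving.swap i)

    interleaving-none : ∀ {L A : List (Fin k)} → Interleaving A [] L → A ≡ L
    interleaving-none [] = refl
    interleaving-none (consˡ i) = cong (_ ∷_) (interleaving-none i)

    none-interleaving : ∀ (L : List (Fin k)) → Interleaving [] L L
    none-interleaving [] = []
    none-interleaving (x ∷ L) = consʳ (none-interleaving L)

    transfer : ∀ {L A B : List (Fin k)} {x} → Interleaving A B L → x ∈ B →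
      ∃[ A′ ] ∃[ B′ ] (Interleaving A′ B′ L × length B ≡ suc (length B′) ×
        (∀ {y} → y ∈ A → y ∈ A′) × x ∈ A′ × (∀ {y} → y ∈ A′ → y ≡ x ⊎ y ∈ A))
    transfer (consˡ i) x∈ =
      let A′ , B′ , i′ , len , ⊆A′ , x∈A′ , A′⊆ = transfer i x∈ in
      _ ∷ A′ , B′ , consˡ i′ , len , (λ { (here e) → here e ; (there y∈) → there (⊆A′ y∈) }) , there x∈A′ ,
      λ { (here e) → inj₂ (here e) ; (there y∈) → Sum.map₂ there (A′⊆ y∈) }
    transfer (consʳ i) (here refl) = _ , _ , consˡ i , refl , there , here refl ,
      λ { (here e) → inj₁ e ; (there y∈) → inj₂ y∈ }
    transfer (consʳ i) (there x∈) =
      let A′ , B′ , i′ , len , rest = transfer i x∈ in A′ , _ ∷ B′ , consʳ i′ , cong suc len , rest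

    record Part (L A B : List (Fin k)) : Set where
      constructor part
      field
        interleaving : Interleaving A B L
        independent  : Independent A B

    part-swap : ∀ {L A B} → Part L A B → Part L B A
    part-swap (part i indep) = part (Interleaving.swap i) λ x∈ y∈ d → indep y∈ x∈ (dependent-sym d)

    part-split : ∀ {L A B} → Part L A B → Split L A B
    part-split (part i indep) = independent-split i λ x∈ y∈ d → indep y∈ x∈ (dependent-sym d)

    interleaving-assoc : ∀ {L K R A B : List (Fin k)} → Interleaving K R L → Interleaving A B R →
                         ∃[ C ] (Interleaving A C L × Interleaving K B C)
    interleaving-assoc [] [] = [] , [] , []
    interleaving-assoc (consˡ i) j = let C , i′ , j′ = interleaving-assoc i j in _ ∷ C , consʳ i′ , consˡ j′
    interleaving-assoc (consʳ i) (consˡ j) = let C , i′ , j′ = interleaving-assoc i j in C , consˡ i′ , j′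
    interleaving-assoc (consʳ i) (consʳ j) = let C , i′ , j′ = interleaving-assoc i j in _ ∷ C , consʳ i′ , consʳ j′

    -- A component of what remains beside `K` is also a union of components of the whole; this is
    -- what allows `heir` to be applied to it.
    part-assoc : ∀ {L K R A B} → Part L K R → Part R A B → ∃[ C ] Part L A C
    part-assoc (part i indep) (part j indep′) = let C , i′ , j′ = interleaving-assoc i j in
      C , part i′ λ x∈ y∈ → [ (λ y∈K d → indep y∈K (interleaving-⊆ˡ j x∈) (dependent-sym d)) , indep′ x∈ ]′ (interleaving-∈ j′ y∈)

    component : ∀ {L x} → x ∈ L → ∃[ A ] ∃[ B ] (Part L A B × x ∈ A × Connected A)
    component {L} {x} x∈L =
      let A , B , i , _ , _ , x∈A , A⊆ = transfer (none-interleaving L) x∈L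
      in grow (length B) A B ℕₚ.≤-refl i x∈A λ y∈ → [ (λ { refl → ⟨⟩ }) , (λ ()) ]′ (A⊆ y∈)
      where
      -- Flips migrate from `B` to the part `A` already reached from `x`; `m` bounds the number left
      -- and makes the recursion structural.
      grow : ∀ m A B → length B ℕ.≤ m → Interleaving A B L → x ∈ A → (∀ {y} → y ∈ A → Path A x y) →
             ∃[ A ] ∃[ B ] (Part L A B × x ∈ A × Connected A)
      grow m A B B≤m i x∈A paths with any? (λ y → any? (λ z → dependent? z y) A) B | m
      ... | no none | _ = A , B , part i (λ z∈ y∈ d → none (lose y∈ (lose z∈ d))) , x∈A ,
                          λ y∈ z∈ → path-sym (paths y∈) Star.◅◅ paths z∈
      ... | yes some | zero = ⊥-elim (nonempty B≤m some)
        where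
        nonempty : ∀ {B} {P : Fin k → Set} → length B ℕ.≤ zero → ¬ Any P B
        nonempty {[]} _ ()
      ... | yes some | suc m′ =
        let y , y∈B , some′ = find some
            z , z∈A , d = find some′
            A′ , B′ , i′ , len , A⊆A′ , y∈A′ , A′⊆ = transfer i y∈B
        in grow m′ A′ B′ (ℕₚ.≤-pred (subst (ℕ._≤ suc m′) len B≤m)) i′ (A⊆A′ x∈A) λ w∈ →
             [ (λ { refl → path-⊆ A⊆A′ (paths z∈A) Star.◅◅ ((d , A⊆A′ z∈A , y∈A′) ◂ ⟨⟩) })
             , (λ w∈A → path-⊆ A⊆A′ (paths w∈A)) ]′ (A′⊆ w∈)

    -- Since `f` is the only way out of `A`, a path to `f` must step onto it directly from `A`.
    path-leaves : ∀ {L A f x} → (∀ {y z} → y ∈ A → z ∈ L → z ≢ f → Dependent y z → z ∈ A) →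
                  x ∈ A → x ≢ f → Path L x f → ∃[ y ] (y ∈ A × Dependent y f)
    path-leaves closed x∈A x≢f ⟨⟩ = ⊥-elim (x≢f refl)
    path-leaves {f = f} closed x∈A x≢f (_◂_ {j = z} (d , _ , z∈) p) with z Fin.≟ f
    ... | yes refl = _ , x∈A , d
    ... | no  z≢f  = path-leaves closed (closed x∈A z∈ z≢f d) z≢f p

    record Root (T : List Triangle) (L : List (Fin k)) (f : Fin k) (L′ : List (Fin k)) (W : List Triangle) : Set where
      field
        {after}   : List Triangle
        good      : Good T
        flip      : Fire T f after
        play      : Play after L′ W
        source    : IsSource L f L′
        sorted    : Sorted L
        connected : Connected L

      sorted′ : Sorted L′
      sorted′ = proj₂ (split-sorted source sorted)

      f∈L : f ∈ L
      f∈L = split-⊆ˡ source (here refl)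

      f∉L′ : f ∉ L′
      f∉L′ = split-disjoint source sorted (here refl)

    -- Connectedness of `L` forces some flip of `A` to depend on `f`. The part `A` can be played
    -- immediately after `f`, so if it used no triangle of `f`, all of it would be independent of
    -- `f`.
    heir : ∀ {T L f L′ W A B y} → Root T L f L′ W → Part L′ A B → y ∈ A →
           ∃[ t ] ∃[ c ] (t ∈ outs f × FirstConsumer A t c)
    heir {f = f} {L′} {A = A} {B} {y} root pt@(part i indep) y∈A
      with any? (λ t → any? (λ x → t ∈? ins x) A) (outs f)
    ... | yes some = let t , o , some′ = find some
                         x , x∈ , j = find some′
                         c , fc = first-consumer (proj₁ (split-sorted (part-split pt) sorted′)) x∈ j
                     in t , c , o , fc
      where open Root root
    ... | no none =
      let V , pA , pB = split-play (part-split pt) play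
          x , x∈ , d = path-leaves closed y∈A (λ { refl → f∉L′ (interleaving-⊆ˡ i y∈A) }) (connected (split-⊆ʳ source (interleaving-⊆ˡ i y∈A)) f∈L)
      in ⊥-elim (unused-independent good flip pA (λ x∈ o j → none (lose o (lose x∈ j))) x∈ (dependent-sym d))
      where
      open Root root
      closed : ∀ {y z} → y ∈ A → z ∈ _ → z ≢ f → Dependent y z → z ∈ A
      closed y∈ z∈ z≢f d with split-∈ source z∈
      ... | inj₁ (here e) = ⊥-elim (z≢f e)
      ... | inj₂ z∈L′ with interleaving-∈ i z∈L′
      ...   | inj₁ z∈A = z∈A
      ...   | inj₂ z∈B = ⊥-elim (indep y∈ z∈B d)

    consumers-clash : ∀ {A B t u c d} → Independent A B → FirstConsumer A t c → FirstConsumer B u d → t ≢ u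
    consumers-clash indep (c∈ , i , _) (d∈ , j , _) refl = indep c∈ d∈ (in-in i j)

    pigeonhole : ∀ {f t₁ t₂ t₃} → t₁ ∈ outs f → t₂ ∈ outs f → t₃ ∈ outs f → t₁ ≢ t₂ → t₁ ≢ t₃ → t₂ ≡ t₃
    pigeonhole p q r ≢₁₂ ≢₁₃ with ∈-pair p | ∈-pair q | ∈-pair r
    ... | inj₁ refl | inj₁ refl | _         = ⊥-elim (≢₁₂ refl)
    ... | inj₁ refl | _         | inj₁ refl = ⊥-elim (≢₁₃ refl)
    ... | inj₁ refl | inj₂ refl | inj₂ refl = refl
    ... | inj₂ refl | inj₂ refl | _         = ⊥-elim (≢₁₂ refl)
    ... | inj₂ refl | _         | inj₂ refl = ⊥-elim (≢₁₃ refl)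
    ... | inj₂ refl | inj₁ refl | inj₁ refl = refl

    -- A flip creates only two triangles, so its removal leaves at most two components.
    rest-connected : ∀ {T L f L′ W A B t c} → Root T L f L′ W → Part L′ A B →
                     t ∈ outs f → FirstConsumer A t c → Connected B
    rest-connected {B = B} root ptAB@(part i indep) o fc {x} {y} x∈B y∈B with component x∈B
    ... | B₁ , B₂ , ptB@(part j indep′) , x∈B₁ , conn with interleaving-∈ j y∈B
    ...   | inj₁ y∈B₁ = path-⊆ (interleaving-⊆ˡ j) (conn x∈B₁ y∈B₁)
    ...   | inj₂ y∈B₂ =
      let _ , pt₁ = part-assoc ptAB ptB
          _ , pt₂ = part-assoc ptAB (part-swap ptB)
          t₁ , c₁ , o₁ , fc₁ = heir root pt₁ x∈B₁
          t₂ , c₂ , o₂ , fc₂ = heir root pt₂ y∈B₂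
      in ⊥-elim (consumers-clash indep′ fc₁ fc₂
           (pigeonhole o o₁ o₂ (consumers-clash (λ a∈ b∈ → indep a∈ (interleaving-⊆ˡ j b∈)) fc fc₁)
                               (consumers-clash (λ a∈ b∈ → indep a∈ (interleaving-⊆ʳ j b∈)) fc fc₂)))

    -- Tours of the agent

    -- Records how the order arose from successive splits instead of stating an order condition;
    -- `topo-order` recovers the latter.
    data Topo : List (Fin k) → List (Fin k) → Set where
      []     : Topo [] []
      single : ∀ {x} → Topo (x ∷ []) (x ∷ [])
      join   : ∀ {L A B is js} → Split L A B → Topo is A → Topo js B → Topo (is ++ js) L

    -- δ is the number of actions saved; M and rest belong to the run that continues the tour.
    Tour : ℕ → List Triangle → Edge → List Edge → List (Fin k) → ℕ → List Flip → Set
    Tour δ T e s L M rest =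
      ∃[ m ] ∃[ js ] (Topo js L × Run T e s m (map F js ++ rest) × m ℕ.+ δ ℕ.≤ 2 ℕ.* length L ℕ.+ M)

    weaken : ∀ {δ T e s L M rest} → Tour (suc δ) T e s L M rest → Tour δ T e s L M rest
    weaken {δ} (m , js , topo , run , bound) = m , js , topo , run , ℕₚ.≤-trans (ℕₚ.+-monoʳ-≤ m (ℕₚ.n≤1+n δ)) bound

    -- The choice of action for the last flip of a tour is left to the caller: a `flipMove` at the
    -- very end, a `flipPop` when a second component is waiting. The neighbour `e′` is supplied for
    -- the first case.
    Finish : List Edge → List Triangle → ℕ → List Flip → Set
    Finish s W M rest = ∀ {T e g e′} → Step T (e , g) W → ShareTri T e e′ → Run T e s (suc M) ((e , g) ∷ rest)

    record State (T : List Triangle) (L : List (Fin k)) (W : List Triangle) : Set where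
      field
        good      : Good T
        play      : Play T L W
        sorted    : Sorted L
        connected : Connected L

    rooted : ∀ {T L f L′ W} → State T L W → IsSource L f L′ → Root T L f L′ W
    rooted st source with split-play source (State.play st)
    ... | V , g ▸ done U≈V , p = record
      { good = State.good st ; flip = g ; play = ≈-play U≈V p ; source = source
      ; sorted = State.sorted st ; connected = State.connected st }

    step : ∀ {T x U} → Fire T x U → Step T (F x) U
    step {x = x} = FlipProperties.fires⇒step (quads x)

    -- The next edge is known from a triangle present after the flip, but the action requires a
    -- triangle shared before it; a side of the quadrilateral has both.
    leave : ∀ {T x U e t} → Good T → Fire T x U → t ∈ outs x → EdgeOf e t → e ≢ φ (F x) → ShareTri T (ε (F x)) e
    leave {x = x} {e = e} {t} good g o e∈t e≢φ =
      let t′ , i , e∈t′ = FlipProperties.boundary-old (quads x) {e} o e∈t e≢φ in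
      (λ { refl → FlipProperties.ε-not-produced (quads x) {t} o e∈t }) ,
      t′ , Fires.enabled g i , FlipProperties.ε-consumed (quads x) i , e∈t′

    -- One flip earns two actions and uses one, so the saving grows by one.
    cost₁ : ∀ a m δ M → m ℕ.+ δ ℕ.≤ 2 ℕ.* a ℕ.+ M → suc m ℕ.+ suc δ ℕ.≤ 2 ℕ.* suc a ℕ.+ M
    cost₁ a m δ M bound = begin
      suc m ℕ.+ suc δ            ≡⟨ cong suc (ℕₚ.+-suc m δ) ⟩
      2 ℕ.+ (m ℕ.+ δ)            ≤⟨ ℕₚ.+-monoʳ-≤ 2 bound ⟩
      2 ℕ.+ (2 ℕ.* a ℕ.+ M)      ≡⟨ sym (ℕₚ.+-assoc 2 (2 ℕ.* a) M) ⟩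
      2 ℕ.+ 2 ℕ.* a ℕ.+ M        ≡⟨ cong (ℕ._+ M) (sym (ℕₚ.*-suc 2 a)) ⟩
      2 ℕ.* suc a ℕ.+ M          ∎
      where open ℕₚ.≤-Reasoning

    -- In the second bound `suc m` includes the move away from the popped edge, and the `1` on the
    -- left is the reserve of the tour of `B`. They cancel, and `cost₁` does the rest.
    cost₂ : ∀ b a m m′ δ M → m ℕ.+ δ ℕ.≤ 2 ℕ.* a ℕ.+ M → m′ ℕ.+ 1 ℕ.≤ 2 ℕ.* b ℕ.+ suc m →
            suc m′ ℕ.+ suc δ ℕ.≤ 2 ℕ.* suc (b ℕ.+ a) ℕ.+ M
    cost₂ b a m m′ δ M bound bound′ = cost₁ (b ℕ.+ a) m′ δ M (begin
      m′ ℕ.+ δ                             ≤⟨ ℕₚ.+-monoˡ-≤ δ m′≤ ⟩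
      2 ℕ.* b ℕ.+ m ℕ.+ δ                  ≡⟨ ℕₚ.+-assoc (2 ℕ.* b) m δ ⟩
      2 ℕ.* b ℕ.+ (m ℕ.+ δ)                ≤⟨ ℕₚ.+-monoʳ-≤ (2 ℕ.* b) bound ⟩
      2 ℕ.* b ℕ.+ (2 ℕ.* a ℕ.+ M)          ≡⟨ sym (ℕₚ.+-assoc (2 ℕ.* b) (2 ℕ.* a) M) ⟩
      2 ℕ.* b ℕ.+ 2 ℕ.* a ℕ.+ M            ≡⟨ cong (ℕ._+ M) (sym (ℕₚ.*-distribˡ-+ 2 b a)) ⟩
      2 ℕ.* (b ℕ.+ a) ℕ.+ M                ∎)
      where
      open ℕₚ.≤-Reasoning
      m′≤ : m′ ℕ.≤ 2 ℕ.* b ℕ.+ m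
      m′≤ = ℕₚ.≤-pred (subst₂ ℕ._≤_ (ℕₚ.+-comm m′ 1) (ℕₚ.+-suc (2 ℕ.* b) m) bound′)

    -- The agent may start at any present edge, provided that `f` is the first flip of it. The saved
    -- action is already visible for a single flip, which takes one of its two actions.
    Conquers : ℕ → Set
    Conquers N = ∀ {T L W f s M rest} → length L ℕ.≤ N → State T L W → FirstFlip L f → Present T f →
                 Finish s W M rest → Tour 1 T (ε (F f)) s L M rest

    consumer-ready : ∀ {T L W t c} → State T L W → t ∈ T → FirstConsumer L t c → FirstFlip L c × Present T c
    consumer-ready {t = t} {c} st t∈T fc@(_ , i , _) =
      first-consumer-flips-first {t = t} (State.good st) (State.play st) (State.sorted st) t∈T fc ,
      t , t∈T , FlipProperties.ε-consumed (quads c) i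

    -- A second component B is toured before A, the stack leading back to φ f.
    flip-and-continue : ∀ {N δ T L f L′ W A B t c s M rest e₁} → Conquers N → Root T L f L′ W → length L′ ℕ.≤ N →
      Part L′ A B → t ∈ outs f → FirstConsumer A t c → EdgeOf e₁ t → e₁ ≢ φ (F f) →
      (∀ {V} → Good V → Play V A W → t ∈ V → Tour δ V e₁ s A M rest) →
      Tour (suc δ) T (ε (F f)) s L M rest
    flip-and-continue {δ = δ} {T} {L} {f} {L′} {W} {A} {[]} {t} {c} {s} {M} {rest} {e₁} conquers root L′≤N (part i _) o fc e₁∈t e₁≢φ next
      with refl ← interleaving-none i =
      let open Root root
          m , js , topo , run , bound = next (fire-good good flip) play (produced flip o)
      in suc m , f ∷ js , join source single topo ,
         flipMove (step flip) (leave {e = e₁} {t} good flip o e₁∈t e₁≢φ) run ,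
         subst (λ l → suc m ℕ.+ suc δ ℕ.≤ 2 ℕ.* l ℕ.+ M) (sym (split-length source)) (cost₁ (length A) m δ M bound)
    flip-and-continue {δ = δ} {T} {L} {f} {L′} {W} {A} {B@(y ∷ _)} {t} {c} {s} {M} {rest} {e₁} conquers root L′≤N pt o fc e₁∈t e₁≢φ next =
      let open Root root
          good′ = fire-good good flip
          t₂ , c₂ , o₂ , fc₂ = heir root (part-swap pt) (here refl)
          splitBA = part-split (part-swap pt)
          V , pB , pA = split-play splitBA play
          -- The flip that consumes `t` is in `A`, and flips of `B` share no triangle with it. So
          -- `t` still joins `φ (F f)` to `e₁` when the agent returns.
          untouched : ∀ {y} → y ∈ B → t ∉ ins y
          untouched y∈ j = Part.independent pt (proj₁ fc) y∈ (in-in (proj₁ (proj₂ fc)) j)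
          t∈V = unconsumed-kept pB (produced flip o) untouched
          sortedB = proj₁ (split-sorted splitBA sorted′)
          m , js , topo , run , bound = next (play-good good′ pB) pA t∈V
          back : Finish (φ (F f) ∷ s) V (suc m) (map F js ++ rest)
          back st sh = flipPop st (move ((λ φ≡e₁ → e₁≢φ (sym φ≡e₁)) , t , t∈V , FlipProperties.φ-produced (quads f) o , e₁∈t) run)
          stB = record { good = good′ ; play = pB ; sorted = sortedB ; connected = rest-connected root pt o fc }
          first₂ , present₂ = consumer-ready {t = t₂} stB (produced flip o₂) fc₂
          B≤N = ℕₚ.≤-trans (ℕₚ.≤-trans (ℕₚ.m≤m+n (length B) (length A)) (ℕₚ.≤-reflexive (sym (split-length splitBA)))) L′≤N
          m′ , js′ , topo′ , run′ , bound′ = conquers B≤N stB first₂ present₂ back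
          -- Flipping the new edge consumes both triangles at it, so `B` would have to consume `t`
          -- as well.
          ε₂≢φ : ε (F c₂) ≢ φ (F f)
          ε₂≢φ ε₂≡φ = let _ , y∈ , j , _ = flipped-consumed {x = c₂} {t = t} good′ pB sortedB (produced flip o) (proj₁ fc₂)
                                             (subst (λ e → EdgeOf e t) (sym ε₂≡φ) (FlipProperties.φ-produced (quads f) o))
                      in untouched y∈ j
          flips-≡ : map F js′ ++ (map F js ++ rest) ≡ map F (js′ ++ js) ++ rest
          flips-≡ = trans (sym (++-assoc (map F js′) (map F js) rest)) (cong (_++ rest) (sym (map-++ F js′ js)))
          length-≡ : length L ≡ suc (length B ℕ.+ length A)
          length-≡ = trans (split-length source) (cong suc (split-length splitBA))
      in suc m′ , f ∷ (js′ ++ js) , join source single (join splitBA topo′ topo) ,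
         flipPush (step flip) (leave {e = ε (F c₂)} {t₂} good flip o₂ (FlipProperties.ε-consumed (quads c₂) (proj₁ (proj₂ fc₂))) ε₂≢φ)
           (subst (Run _ _ _ m′) flips-≡ run′) ,
         subst (λ l → suc m′ ℕ.+ suc δ ℕ.≤ 2 ℕ.* l ℕ.+ M) (sym length-≡) (cost₂ (length B) (length A) m m′ δ M bound bound′)

    part-length : ∀ {L A B} → Part L A B → length A ℕ.≤ length L
    part-length {A = A} {B} pt = ℕₚ.≤-trans (ℕₚ.m≤m+n (length A) (length B)) (ℕₚ.≤-reflexive (sym (split-length (part-split pt))))

    -- The agent cannot stay at the new edge, hence the detour over a neighbouring edge.
    flip-and-return : ∀ {N T L f L′ W A B t c s M rest} → Conquers N → Root T L f L′ W → length L′ ℕ.≤ N →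
      Part L′ A B → Connected A → t ∈ outs f → FirstConsumer A t c → ε (F c) ≡ φ (F f) →
      Finish s W M rest → Tour 1 T (ε (F f)) s L M rest
    flip-and-return {f = f} {A = A} {[]} {t} {c} {s} {M} {rest} conquers root L′≤N (part i _) connA o fc εc≡φ finish
      with refl ← interleaving-none i =
      let open Root root
          st = record { good = fire-good good flip ; play = play ; sorted = sorted′ ; connected = connA }
          first₁ , present₁ = consumer-ready {t = t} st (produced flip o) fc
          m , js , topo , run , bound = conquers L′≤N st first₁ present₁ finish
          e , t′ , u , i , e∈t′ , e≢ε , o′ , e∈u , e≢φ = FlipProperties.boundary-edge (quads f)
      in suc (suc m) , f ∷ js , join source single topo ,
         flipMove (step flip) ((λ ε≡e → e≢ε (sym ε≡e)) , t′ , Fires.enabled flip i , FlipProperties.ε-consumed (quads f) i , e∈t′)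
           (move ((λ e≡εc → e≢φ (trans e≡εc εc≡φ)) , u , produced flip o′ , e∈u ,
                  subst (λ e → EdgeOf e u) (sym εc≡φ) (FlipProperties.φ-produced (quads f) o′)) run) ,
         subst (λ l → suc (suc m) ℕ.+ 1 ℕ.≤ 2 ℕ.* l ℕ.+ M) (sym (split-length source))
           (cost₁ (length A) (suc m) 0 M (subst (ℕ._≤ 2 ℕ.* length A ℕ.+ M) (trans (ℕₚ.+-comm m 1) (sym (ℕₚ.+-identityʳ (suc m)))) bound))
    flip-and-return {f = f} {A = A} {B@(y ∷ _)} {t} {c} conquers root L′≤N pt connA o fc εc≡φ finish =
      let open Root root
          t₂ , c₂ , o₂ , c₂∈B , i₂ , _ = heir root (part-swap pt) (here refl)
          V , pA , pB = split-play (part-split pt) play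
          -- A second component is impossible here: flipping the new edge inside `A` also uses up
          -- `t₂`, the triangle that `B` needs.
          y , y∈A , j , _ = flipped-consumed {x = c} {t = t₂} (fire-good good flip) pA (proj₁ (split-sorted (part-split pt) sorted′))
                              (produced flip o₂) (proj₁ fc)
                              (subst (λ e → EdgeOf e t₂) (sym εc≡φ) (FlipProperties.φ-produced (quads f) o₂))
      in ⊥-elim (Part.independent pt y∈A c₂∈B (in-in j i₂))

    flip-and-finish : ∀ {N T L f L′ W s M rest} → Conquers N → Root T L f L′ W → length L′ ℕ.≤ N →
                      Finish s W M rest → Tour 1 T (ε (F f)) s L M rest
    flip-and-finish {f = f} {[]} {M = M} conquers root L′≤N finish with Root.play root
    ... | done U≈W =
      let open Root root
          e , t , _ , i , e∈t , e≢ε , _ = FlipProperties.boundary-edge (quads f)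
      in suc M , f ∷ [] , join source single [] ,
         finish (step (fire-≈ flip U≈W)) ((λ ε≡e → e≢ε (sym ε≡e)) , t , Fires.enabled flip i , FlipProperties.ε-consumed (quads f) i , e∈t) ,
         subst (λ l → suc M ℕ.+ 1 ℕ.≤ 2 ℕ.* l ℕ.+ M) (sym (split-length source)) (ℕₚ.≤-reflexive (cong suc (ℕₚ.+-comm M 1)))
    flip-and-finish {f = f} {L′@(y ∷ _)} {W} {s} {M} {rest} conquers root L′≤N finish
      with heir root (part (Interleaving.swap (none-interleaving L′)) λ _ ()) (here refl)
    ... | t , c , o , c∈L′ , i , _ with component c∈L′
    ... | A , B , pt , c∈A , connA with first-consumer (proj₁ (split-sorted (part-split pt) (Root.sorted′ root))) c∈A i
    ... | c₁ , fc₁ with ε (F c₁) ≟ᵉ φ (F f)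
    -- This case saves two actions. The other one spends the additional action on its detour, so
    -- only one saving is promised.
    ... | no ε₁≢φ = weaken (flip-and-continue conquers root L′≤N pt o fc₁ (FlipProperties.ε-consumed (quads c₁) (proj₁ (proj₂ fc₁))) ε₁≢φ next)
      where
      open Root root
      next : ∀ {V} → Good V → Play V A W → t ∈ V → Tour 1 V (ε (F c₁)) s A M rest
      next goodV p t∈V =
        let st = record { good = goodV ; play = p ; sorted = proj₁ (split-sorted (part-split pt) sorted′) ; connected = connA }
            first₁ , present₁ = consumer-ready {t = t} st t∈V fc₁
        in conquers (ℕₚ.≤-trans (part-length pt) L′≤N) st first₁ present₁ finish
    ... | yes ε₁≡φ = flip-and-return conquers root L′≤N pt connA o fc₁ ε₁≡φ finish

    part-path : ∀ {L A B x y} → Part L A B → x ∈ A → Path L x y → y ∈ A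
    part-path pt x∈A ⟨⟩ = x∈A
    part-path pt x∈A ((d , _ , z∈) ◂ p) with interleaving-∈ (Part.interleaving pt) z∈
    ... | inj₁ z∈A = part-path pt z∈A p
    ... | inj₂ z∈B = ⊥-elim (Part.independent pt x∈A z∈B d)

    -- All members of a chain are themselves reachable from its start, so it suffices that `L′`
    -- keeps what is reachable.
    chain-into : ∀ {L L′ x y} → (∀ {z} → Chain L x z → z ∈ L′) → Chain L x y → Chain L′ x y
    chain-into reaches ⟨⟩ = ⟨⟩
    chain-into reaches (l@(x<z , d , _) ◂ c) =
      (x<z , d , reaches ⟨⟩ , reaches (l ◂ ⟨⟩)) ◂ chain-into (λ c′ → reaches (l ◂ c′)) c

    nonempty : ∀ {L : List (Fin k)} {x} → x ∈ L → ¬ length L ℕ.≤ 0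
    nonempty (here _) ()
    nonempty (there _) ()

    -- Flips preceding f can be performed, always returning to the edge of f, until f is a source.
    Reaches : ℕ → Fin k → Set
    Reaches N f = ∀ {T L W s M rest δ} → length L ℕ.≤ N → State T L W → FirstFlip L f → Present T f →
      (∀ {T′ L′ L″} → Root T′ L′ f L″ W → length L′ ℕ.≤ N → (∀ {x} → x ∈ L′ → x ∈ L) → (∀ {y} → Chain L f y → y ∈ L′) →
       Tour δ T′ (ε (F f)) s L′ M rest) →
      Tour δ T (ε (F f)) s L M rest

    -- Moving to a threat leaves the list unchanged but goes to a smaller index, hence the inner
    -- well-founded recursion. Once the threat is flipped the list is shorter, and `reaches-N f`
    -- takes over. The spare action of that flip pays for the move.
    reach-step : ∀ {N f} → Conquers N → (∀ g → Reaches N g) → Acc Fin._<_ f → Reaches (suc N) f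
    reach-step {N} {f} conquers reaches-N (acc smaller) {T} {L} {W} {s} {M} {rest} {δ} L≤ st ff@(f∈ , unflipped) present continue
      with source-or-threat (State.good st) (State.play st) (State.sorted st) ff present
    ... | inj₁ (L′ , source) = continue (rooted st source) L≤ id (chain-end f∈)
    ... | inj₂ (p , t , p<f , t∈T , e∈t , fc@(p∈ , i , _) , chain) =
      let first-p , present-p = consumer-ready {t = t} st t∈T fc
          m , js , topo , run , bound = reach-step conquers reaches-N (smaller p<f) L≤ st first-p present-p detour
      in suc m , js , topo , move (f≢p , t , t∈T , e∈t , FlipProperties.ε-consumed (quads p) i) run ,
         subst (ℕ._≤ 2 ℕ.* length L ℕ.+ M) (ℕₚ.+-suc m δ) bound
      where
      f≢p : ε (F f) ≢ ε (F p)
      f≢p = unflipped p∈ p<f ∘ sym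
      detour : ∀ {T′ L′ L″} → Root T′ L′ p L″ W → length L′ ℕ.≤ suc N → (∀ {x} → x ∈ L′ → x ∈ L) →
               (∀ {y} → Chain L p y → y ∈ L′) → Tour (suc δ) T′ (ε (F p)) s L′ M rest
      detour {T′} {L′} {L″} root L′≤ L′⊆L reaches
        with split-∈ (Root.source root) (reaches chain)
      ... | inj₁ (here refl) = ⊥-elim (Fin.<-irrefl refl p<f)
      ... | inj₂ f∈L″ with component f∈L″ | FlipProperties.boundary-kept (quads p) {ε (F f)} {t} i e∈t f≢p
      ... | A , B , pt , f∈A , connA | u , o , e∈u =
        -- The chain from the consumer `q` of `u` to `f` puts `q` into the component `A` of `f`.
        -- Thus `u` is inherited by `A`, and the other component leaves it alone until the agent is
        -- back.
        let q , (q∈ , j , _) , back = lineage {t = u} (fire-good good flip) play sorted′ (first-flip-⊆ L″⊆L f∈L″ ff) (produced flip o) e∈u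
            q∈A = part-path pt f∈A (path-sym (chain⇒path back))
            c , fc′ = first-consumer sortedA q∈A j
        in flip-and-continue conquers root L″≤N pt o fc′ e∈u ε≢φ next
        where
        open Root root
        L″⊆L : ∀ {x} → x ∈ L″ → x ∈ L
        L″⊆L = L′⊆L ∘ split-⊆ʳ source
        A⊆L″ : ∀ {x} → x ∈ A → x ∈ L″
        A⊆L″ = split-⊆ˡ (part-split pt)
        sortedA : Sorted A
        sortedA = proj₁ (split-sorted (part-split pt) sorted′)
        L″≤N : length L″ ℕ.≤ N
        L″≤N = ℕₚ.≤-pred (subst (ℕ._≤ suc N) (split-length source) L′≤)
        ε≢φ : ε (F f) ≢ φ (F p)
        ε≢φ ε≡φ = FlipProperties.φ-new (quads p) {t = t} good (Fires.enabled flip) (Fires.enabled flip i) (subst (λ e → EdgeOf e t) ε≡φ e∈t)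
        -- What is reachable from `f` survives every cut: it stays behind while `L` shrinks to `L′`,
        -- after `p` is removed, and when only the component `A` is kept.
        descend : ∀ {y} → Chain L f y → Chain A f y
        descend c = chain-later (part-split (part-swap pt)) sorted′ f∈A
          (chain-later source sorted f∈L″ (chain-into (λ c′ → reaches (chain Star.◅◅ c′)) c))
        next : ∀ {V} → Good V → Play V A W → u ∈ V → Tour δ V (ε (F f)) s A M rest
        next goodV play′ u∈V = reaches-N f (ℕₚ.≤-trans (part-length pt) L″≤N)
          (record { good = goodV ; play = play′ ; sorted = sortedA ; connected = connA })
          (first-flip-⊆ (L″⊆L ∘ A⊆L″) f∈A ff) (u , u∈V , e∈u)
          λ root′ len ⊆A reaches′ → continue root′ (ℕₚ.m≤n⇒m≤1+n len) (L″⊆L ∘ A⊆L″ ∘ ⊆A) (reaches′ ∘ descend)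

    conquers-and-reaches : ∀ N → Conquers N × (∀ f → Reaches N f)
    conquers-and-reaches zero =
      (λ L≤0 _ (f∈ , _) _ _ → ⊥-elim (nonempty f∈ L≤0)) , λ f L≤0 _ (f∈ , _) _ _ → ⊥-elim (nonempty f∈ L≤0)
    conquers-and-reaches (suc N) = conquers , reaches
      where
      conquers-N = proj₁ (conquers-and-reaches N)
      reaches : ∀ f → Reaches (suc N) f
      reaches f = reach-step conquers-N (proj₂ (conquers-and-reaches N)) (Fin.<-wellFounded f)
      conquers : Conquers (suc N)
      conquers {f = f} L≤ st first₁ present finish = reaches f L≤ st first₁ present λ root L′≤ _ _ →
        flip-and-finish conquers-N root (ℕₚ.≤-pred (subst (ℕ._≤ suc N) (split-length (Root.source root)) L′≤)) finish

    -- Arcs of D_F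

    -- Every triangle now at `e` was produced by a flip that a chain leads to from `i`. The field
    -- `present` ensures that no flip can create `e` afresh, and the last clause of `origin` keeps
    -- later links ascending.
    record Descends (M : List (Fin k)) (i : Fin k) (e : Edge) (U : List Triangle) (L : List (Fin k)) : Set where
      field
        present : ∃[ t ] (t ∈ U × EdgeOf e t)
        origin  : ∀ {t} → t ∈ U → EdgeOf e t → ∃[ q ] (Chain M i q × t ∈ outs q × (∀ {y} → y ∈ L → q Fin.< y))

    module _ {M : List (Fin k)} (all : ∀ x → x ∈ M) where

      extend : ∀ {i q y t} → Chain M i q → q Fin.< y → t ∈ outs q → t ∈ ins y → Chain M i y
      extend c q<y o i = c Star.◅◅ ((q<y , out-in o i , all _ , all _) ◂ ⟨⟩)

      -- A flip of another edge replaces a triangle at `e` by a new one at `e`, and so extends the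
      -- chain by one link.
      descends-step : ∀ {i e T h U L} → Good T → Fire T h U → Sorted (h ∷ L) → e ≢ ε (F h) →
                      Descends M i e T (h ∷ L) → Descends M i e U L
      descends-step {i} {e} {T} {h} {U} {L} good g (h< ∷ _) e≢ε d = record { present = still ; origin = from }
        where
        open Descends d
        t₀ = proj₁ present
        still : ∃[ t ] (t ∈ U × EdgeOf e t)
        still with t₀ ∈? ins h
        ... | no ∉i = t₀ , kept g (proj₁ (proj₂ present)) ∉i , proj₂ (proj₂ present)
        ... | yes j = let u , o , e∈u = FlipProperties.boundary-kept (quads h) {e} {t₀} j (proj₂ (proj₂ present)) e≢ε
                      in u , produced g o , e∈u
        e≢φ : e ≢ φ (F h)
        e≢φ e≡φ = FlipProperties.φ-new (quads h) {t = t₀} good (Fires.enabled g) (proj₁ (proj₂ present))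
                    (subst (λ e → EdgeOf e t₀) e≡φ (proj₂ (proj₂ present)))
        from : ∀ {t} → t ∈ U → EdgeOf e t → ∃[ q ] (Chain M i q × t ∈ outs q × (∀ {y} → y ∈ L → q Fin.< y))
        from {t} t∈U e∈t with after⁻ g t∈U
        ... | inj₁ (t∈T , _) = let q , c , o , q< = origin t∈T e∈t in q , c , o , q< ∘ there
        ... | inj₂ o =
          let t′ , j , e∈t′ = FlipProperties.boundary-old (quads h) {e} {t} o e∈t e≢φ
              q , c , o′ , q< = origin {t′} (Fires.enabled g j) e∈t′
          in h , extend c (q< (here refl)) o′ j , o , All.lookup h<

      descends-chain : ∀ {i j e t U L W} → Good U → Play U L W → Sorted L → j ∈ L → t ∈ ins j → EdgeOf e t →
                       (∀ {y} → y ∈ L → y Fin.< j → ε (F y) ≢ e) → Descends M i e U L → Chain M i j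
      descends-chain good (g ▸ p) s (here refl) c e∈t _ d =
        let q , ch , o , q< = Descends.origin d (Fires.enabled g c) e∈t in extend ch (q< (here refl)) o c
      descends-chain {e = e} {t} good (g ▸ p) s@(h< ∷ L<) (there j∈) c e∈t unflipped d =
        descends-chain {e = e} {t} (fire-good good g) p L< j∈ c e∈t (unflipped ∘ there)
          (descends-step good g s (unflipped (here refl) (All.lookup h< j∈) ∘ sym) d)

      -- Just after `i`, all triangles at its new edge are its own products. As the edge is not
      -- flipped before `j`, the invariant `Descends` lasts until `j` consumes a triangle there.
      creation-chain : ∀ {i j t T L W} → Good T → Play T L W → Sorted L → i ∈ L → j ∈ L → i Fin.< j →
                       t ∈ ins j → EdgeOf (φ (F i)) t →
                       (∀ p → i Fin.< p → p Fin.< j → ε (F p) ≢ φ (F i)) → Chain M i j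
      creation-chain good (g ▸ p) s (here refl) (here refl) i<j = ⊥-elim (Fin.<-irrefl refl i<j)
      creation-chain good (g ▸ p) s (there i∈) (here refl) i<j = ⊥-elim (head-least s (there i∈) i<j)
      creation-chain good (g ▸ p) (_ ∷ L<) (there i∈) (there j∈) i<j c e∈t unflipped =
        creation-chain (fire-good good g) p L< i∈ j∈ i<j c e∈t unflipped
      creation-chain {i} {j} {t} good (_▸_ {U = U} {L} g p) (h< ∷ L<) (here refl) (there j∈) i<j c e∈t unflipped =
        descends-chain {e = φ (F i)} {t} (fire-good good g) p L< j∈ c e∈t (λ y∈ → unflipped _ (All.lookup h< y∈)) record
          { present = _ , produced g (here refl) , FlipProperties.φ-produced (quads i) (here refl) ; origin = from }
        where
        from : ∀ {t} → t ∈ U → EdgeOf (φ (F i)) t → ∃[ q ] (Chain M i q × t ∈ outs q × (∀ {y} → y ∈ L → q Fin.< y))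
        from {t} t∈U e∈t with after⁻ g t∈U
        ... | inj₁ (t∈T , _) = ⊥-elim (FlipProperties.φ-new (quads i) {t = t} good (Fires.enabled g) t∈T e∈t)
        ... | inj₂ o = i , ⟨⟩ , o , All.lookup h<

    -- Topological sortings

    topo-∈⁻ : ∀ {js L x} → Topo js L → x ∈ js → x ∈ L
    topo-∈⁻ single x∈ = x∈
    topo-∈⁻ (join {is = is} s tA tB) x∈ =
      [ split-⊆ˡ s ∘ topo-∈⁻ tA , split-⊆ʳ s ∘ topo-∈⁻ tB ]′ (∈-++⁻ is x∈)

    topo-∈⁺ : ∀ {js L x} → Topo js L → x ∈ L → x ∈ js
    topo-∈⁺ single x∈ = x∈
    topo-∈⁺ (join {is = is} s tA tB) x∈ = [ ∈-++⁺ˡ ∘ topo-∈⁺ tA , ∈-++⁺ʳ is ∘ topo-∈⁺ tB ]′ (split-∈ s x∈)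

    topo-unique : ∀ {js L} → Topo js L → Sorted L → Unique js
    topo-unique [] _ = []
    topo-unique single _ = [] ∷ []
    topo-unique (join s tA tB) L< = let A< , B< = split-sorted s L< in
      Unique.++⁺ (topo-unique tA A<) (topo-unique tB B<)
        λ (x∈is , x∈js) → split-disjoint s L< (topo-∈⁻ tA x∈is) (topo-∈⁻ tB x∈js)

    occurs-++ˡ : ∀ {x y : Fin k} {is} js → OccursBefore x y is → OccursBefore x y (is ++ js)
    occurs-++ˡ js (us , vs , refl , y∈) = us , vs ++ js , ++-assoc us _ js , ∈-++⁺ˡ y∈

    occurs-++ʳ : ∀ {x y : Fin k} is {js} → OccursBefore x y js → OccursBefore x y (is ++ js)
    occurs-++ʳ is (us , vs , refl , y∈) = is ++ us , vs , sym (++-assoc is us _) , y∈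

    occurs-across : ∀ {x y : Fin k} {is js} → x ∈ is → y ∈ js → OccursBefore x y (is ++ js)
    occurs-across {js = js} x∈ y∈ with ∈-∃++ x∈
    ... | us , vs , refl = us , vs ++ js , ++-assoc us _ js , ∈-++⁺ʳ vs y∈

    -- Uniqueness identifies the two occurrences of `y`.
    occurs-trans : ∀ {x y z : Fin k} {js} → Unique js → OccursBefore x y js → OccursBefore y z js → OccursBefore x z js
    occurs-trans (x≢ ∷ _) ([] , vs , refl , y∈) ([] , _ , refl , _) = ⊥-elim (All.lookup x≢ y∈ refl)
    occurs-trans _ ([] , vs , refl , y∈) (_ ∷ us′ , vs′ , refl , z∈) = [] , vs , refl , ∈-++⁺ʳ us′ (there z∈)
    occurs-trans (u≢ ∷ _) (_ ∷ us , vs , refl , y∈) ([] , _ , refl , _) = ⊥-elim (All.lookup u≢ (∈-++⁺ʳ us (there y∈)) refl)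
    occurs-trans (_ ∷ un) (u ∷ us , vs , refl , y∈) (_ ∷ us′ , vs′ , eq , z∈)
      with occurs-trans un (us , vs , refl , y∈) (us′ , vs′ , proj₂ (∷-injective eq) , z∈)
    ... | ws , xs , eq′ , z∈′ = u ∷ ws , xs , cong (u ∷_) eq′ , z∈′

    topo-order : ∀ {js L x y} → Topo js L → Sorted L → x ∈ L → y ∈ L → x Fin.< y → Dependent x y → OccursBefore x y js
    topo-order single _ (here refl) (here refl) x<y _ = ⊥-elim (Fin.<-irrefl refl x<y)
    topo-order (join {is = is} {js} s tA tB) L< x∈ y∈ x<y d with split-∈ s x∈ | split-∈ s y∈
    ... | inj₁ x∈A | inj₁ y∈A = occurs-++ˡ js (topo-order tA (proj₁ (split-sorted s L<)) x∈A y∈A x<y d)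
    ... | inj₂ x∈B | inj₂ y∈B = occurs-++ʳ is (topo-order tB (proj₂ (split-sorted s L<)) x∈B y∈B x<y d)
    ... | inj₁ x∈A | inj₂ y∈B = occurs-across (topo-∈⁺ tA x∈A) (topo-∈⁺ tB y∈B)
    ... | inj₂ x∈B | inj₁ y∈A = ⊥-elim (split-independent s L< x∈B y∈A x<y d)

    -- An arc need not be a direct dependence, only a chain of them, so the order of its ends is
    -- composed link by link.
    topo-chain : ∀ {js L x y} → Topo js L → Sorted L → x Fin.< y → Chain L x y → OccursBefore x y js
    topo-chain topo L< x<y ⟨⟩ = ⊥-elim (Fin.<-irrefl refl x<y)
    topo-chain topo L< _ ((x<z , d , x∈ , z∈) ◂ ⟨⟩) = topo-order topo L< x∈ z∈ x<z d
    topo-chain topo L< _ ((x<z , d , x∈ , z∈) ◂ c@((z<w , _) ◂ c′)) =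
      occurs-trans (topo-unique topo L<) (topo-order topo L< x∈ z∈ x<z d) (topo-chain topo L< (ℕₚ.<-≤-trans z<w (chain-≤ c′)) c)

    prefix : ∀ t {L} → Sorted L →
             ∃[ A ] ∃[ B ] (Split L A B × (∀ {x} → x ∈ A → Fin.toℕ x ℕ.< t) × (∀ {x} → x ∈ B → t ℕ.≤ Fin.toℕ x))
    prefix t [] = [] , [] , [] , (λ ()) , (λ ())
    prefix t {x ∷ L} (x< ∷ L<) with Fin.toℕ x ℕ.<? t
    ... | yes x<t = let A , B , s , A<t , t≤B = prefix t L< in
          x ∷ A , B , first s , (λ { (here refl) → x<t ; (there y∈) → A<t y∈ }) , t≤B
    ... | no  x≮t = [] , x ∷ L , split-none (x ∷ L) , (λ ()) ,
          λ { (here refl) → ℕₚ.≮⇒≥ x≮t ; (there y∈) → ℕₚ.≤-trans (ℕₚ.≮⇒≥ x≮t) (ℕₚ.<⇒≤ (All.lookup x< y∈)) }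

    -- The lower bound `lo` is a parameter for the sake of the induction, where it rises to one past
    -- the head.
    bounded-length : ∀ t lo {L} → Sorted L → (∀ {x} → x ∈ L → Fin.toℕ x ℕ.< t) → (∀ {x} → x ∈ L → lo ℕ.≤ Fin.toℕ x) →
                     length L ℕ.≤ t ℕ.∸ lo
    bounded-length t lo [] _ _ = z≤n
    bounded-length t lo {x ∷ L} (x< ∷ L<) <t lo≤ = begin
      suc (length L)               ≤⟨ s≤s (bounded-length t (suc (Fin.toℕ x)) L< (<t ∘ there) (All.lookup x<)) ⟩
      suc (t ℕ.∸ suc (Fin.toℕ x))  ≡⟨ sym (ℕₚ.+-∸-assoc 1 (<t (here refl))) ⟩
      t ℕ.∸ Fin.toℕ x              ≤⟨ ℕₚ.∸-monoʳ-≤ t (lo≤ (here refl)) ⟩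
      t ℕ.∸ lo                     ∎
      where open ℕₚ.≤-Reasoning

    tabulate-play : ∀ {l} (ι : Fin l → Fin k) (Us : Fin (suc l) → List Triangle) →
                    (∀ i → Fire (Us (Fin.inject₁ i)) (ι i) (Us (Fin.suc i))) →
                    Play (Us Fin.zero) (tabulate ι) (Us (Fin.fromℕ l))
    tabulate-play {zero}  ι Us fs = done ≈-refl
    tabulate-play {suc l} ι Us fs = fs Fin.zero ▸ tabulate-play (ι ∘ Fin.suc) (Us ∘ Fin.suc) (fs ∘ Fin.suc)

-- From a solution and its arcs to the tour of a component.

module Solution (K : OrderedField) (n : ℕ) (pt : Fin n → Geometry.Point K) where
  open Geometry.PointSet K n pt
  open TriangleProperties K n pt

  module _ (k : ℕ) (F : Fin k → Flip) (Ts : Fin (suc k) → List Triangle)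
           (good₀ : Good (Ts Fin.zero)) (valid : Valid k F Ts) where
    open DAG k F Ts
    open Firing K n pt

    quads : ∀ x → FlipQuad (F x)
    quads x = proj₁ (step⇒fires (valid x))

    open Sequence k F quads

    fired : ∀ x → Fire (Ts (Fin.inject₁ x)) x (Ts (Fin.suc x))
    fired x = proj₂ (step⇒fires (valid x))

    all-good : ∀ i → Good (Ts i)
    all-good = Fin.<-weakInduction (λ i → Good (Ts i)) good₀ λ i good → fire-good good (fired i)

    all-sorted : Sorted (allFin k)
    all-sorted = AllPairs.tabulate⁺-< id

    play-all : Play (Ts Fin.zero) (allFin k) (Ts (Fin.fromℕ k))
    play-all = tabulate-play id Ts fired

    arc-chain : ∀ {i j} → Arc i j → Chain (allFin k) i j
    arc-chain {i} {j} (i<j , contact , unflipped) = let t , c , e∈t = shared contact in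
      creation-chain ∈-allFin {t = t} good₀ play-all all-sorted (∈-allFin i) (∈-allFin j) i<j c e∈t unflipped
      where
      shared : (φ (F i) ≡ ε (F j)) ⊎ ShareTri (Ts (Fin.inject₁ j)) (φ (F i)) (ε (F j)) →
               ∃[ t ] (t ∈ ins j × EdgeOf (φ (F i)) t)
      shared (inj₁ φ≡ε) = FlipQuad.t₁ (quads j) , here refl ,
        subst (λ e → EdgeOf e (FlipQuad.t₁ (quads j))) (sym φ≡ε) (FlipProperties.ε-consumed (quads j) (here refl))
      shared (inj₂ (_ , t , t∈ , φ∈t , ε∈t)) =
        -- A triangle that contains the edge about to be flipped is one of the two consumed.
        t , FlipProperties.consumed-only (quads j) {t = t} (all-good _) (Fires.enabled (fired j)) t∈ ε∈t , φ∈t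

    conn-trans : ∀ {x y z} → Conn x y → Conn y z → Conn x z
    conn-trans c-refl d = d
    conn-trans (c-fwd a c) d = c-fwd a (conn-trans c d)
    conn-trans (c-bwd a c) d = c-bwd a (conn-trans c d)

    module _ (r : Fin k) (t : ℕ) (component-is-prefix : ∀ j → Conn r j ⇔ (Fin.toℕ j ℕ.< t)) where

      C = proj₁ (prefix t all-sorted)
      rest = proj₁ (proj₂ (prefix t all-sorted))

      C-split : Split (allFin k) C rest
      C-split = proj₁ (proj₂ (proj₂ (prefix t all-sorted)))

      C-sorted : Sorted C
      C-sorted = proj₁ (split-sorted C-split all-sorted)

      ∈C⇒< : ∀ {x} → x ∈ C → Fin.toℕ x ℕ.< t
      ∈C⇒< = proj₁ (proj₂ (proj₂ (proj₂ (prefix t all-sorted))))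

      <⇒∈C : ∀ {x} → Fin.toℕ x ℕ.< t → x ∈ C
      <⇒∈C {x} x<t with split-∈ C-split (∈-allFin x)
      ... | inj₁ x∈C = x∈C
      ... | inj₂ x∈rest = ⊥-elim (ℕₚ.<⇒≱ x<t (proj₂ (proj₂ (proj₂ (proj₂ (prefix t all-sorted)))) x∈rest))

      conn⇒∈C : ∀ {x} → Conn r x → x ∈ C
      conn⇒∈C c = <⇒∈C (Equivalence.to (component-is-prefix _) c)

      ∈C⇒conn : ∀ {x} → x ∈ C → Conn r x
      ∈C⇒conn x∈ = Equivalence.from (component-is-prefix _) (∈C⇒< x∈)

      -- Chains ascend and a prefix is closed downwards, so a chain that ends in `C` lies entirely
      -- in `C`.
      chain-below : ∀ {L x y} → y ∈ C → Chain L x y → Chain C x y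
      chain-below y∈C ⟨⟩ = ⟨⟩
      chain-below y∈C ((x<z , d , _) ◂ c) = (x<z , d , below (ℕₚ.≤-trans (ℕₚ.<⇒≤ x<z) (chain-≤ c)) , below (chain-≤ c)) ◂ chain-below y∈C c
        where
        below : ∀ {w} → w Fin.≤ _ → w ∈ C
        below w≤y = <⇒∈C (ℕₚ.≤-<-trans w≤y (∈C⇒< y∈C))

      conn-path : ∀ {x y} → Conn r x → Conn x y → Path C x y
      conn-path rx c-refl = ⟨⟩
      conn-path rx (c-fwd a c) = let ry = conn-trans rx (c-fwd a c-refl) in
        chain⇒path (chain-below (conn⇒∈C ry) (arc-chain a)) Star.◅◅ conn-path ry c
      conn-path rx (c-bwd a c) = let ry = conn-trans rx (c-bwd a c-refl) in
        path-sym (chain⇒path (chain-below (conn⇒∈C rx) (arc-chain a))) Star.◅◅ conn-path ry c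

      C-connected : Connected C
      C-connected x∈ y∈ = path-sym (conn-path c-refl (∈C⇒conn x∈)) Star.◅◅ conn-path c-refl (∈C⇒conn y∈)

      C-length : length C ℕ.≤ t
      C-length = bounded-length t 0 C-sorted ∈C⇒< λ _ → z≤n

      agent : ∀ {Tfin} → Essential (Ts Fin.zero) Tfin r →
        ∃[ h ] (Conn r h × ChangedEdge (Ts Fin.zero) Tfin (ε (F h)) ×
          ∃[ m ] ∃[ js ] (m ℕ.≤ 2 ℕ.* t ×
            Run (Ts Fin.zero) (ε (F h)) [] m (map F js) ×
            Unique js ×
            (∀ j → (j ∈ js) ⇔ Conn r j) ×
            (∀ i j → Arc i j → i ∈ js → j ∈ js → OccursBefore i j js)))
      agent {Tfin} (j , rj , changed) =
        -- The changed edge may be flipped several times in `C`; the earliest such flip is chosen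
        -- because `Conquers` starts from a first flip of an edge.
        let h , h∈ , εh≡ , unflipped = least (λ x → ε (F x) ≟ᵉ ε (F j)) C-sorted (conn⇒∈C rj) refl
            changed-h = subst (ChangedEdge (Ts Fin.zero) Tfin) (sym εh≡) changed
            V , play-C , _ = split-play C-split play-all
            st = record { good = good₀ ; play = play-C ; sorted = C-sorted ; connected = C-connected }
            m , js , topo , run , bound = proj₁ (conquers-and-reaches (length C)) ℕₚ.≤-refl st
              (h∈ , λ x∈ x<h εx≡εh → unflipped x∈ x<h (trans εx≡εh εh≡)) (proj₁ changed-h)
              -- Nothing follows the last flip, so `M` is zero and any neighbouring edge may be the
              -- destination.
              (λ step share → flipMove step share stop)
        in h , ∈C⇒conn h∈ , changed-h , m , js , short bound ,
           subst (Run _ _ [] m) (++-identityʳ (map F js)) run ,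
           topo-unique topo C-sorted ,
           (λ x → mk⇔ (∈C⇒conn ∘ topo-∈⁻ topo) (topo-∈⁺ topo ∘ conn⇒∈C)) ,
           λ x y arc x∈ y∈ → topo-chain topo C-sorted (proj₁ arc) (chain-below (topo-∈⁻ topo y∈) (arc-chain arc))
        where
        short : ∀ {m} → m ℕ.+ 1 ℕ.≤ 2 ℕ.* length C ℕ.+ 0 → m ℕ.≤ 2 ℕ.* t
        short {m} bound = begin
          m                       ≤⟨ ℕₚ.m≤m+n m 1 ⟩
          m ℕ.+ 1                 ≤⟨ bound ⟩
          2 ℕ.* length C ℕ.+ 0    ≡⟨ ℕₚ.+-identityʳ _ ⟩
          2 ℕ.* length C          ≤⟨ ℕₚ.*-monoʳ-≤ 2 C-length ⟩
          2 ℕ.* t                 ∎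
          where open ℕₚ.≤-Reasoning

open import Data.Nat using (_*_; _≤_; _<_)
open import Data.Fin using (toℕ)

theorem1 : (K : OrderedField) (n : ℕ) (pt : Fin n → Geometry.Point K) →
    Injective _≡_ _≡_ pt →
    let open Geometry.PointSet K n pt in
    (Tinit Tfin : List Triangle) →
    IsTriangulation Tinit → IsTriangulation Tfin →
    (k : ℕ) (F : Fin k → Flip) (Ts : Fin (suc k) → List Triangle) →
    IsNormalizedSolution Tinit Tfin k F Ts →
    let open DAG k F Ts in
    -- C = the component of r, and its flips are exactly f_1, …, f_t
    (r : Fin k) (t : ℕ) → (∀ j → Conn r j ⇔ (toℕ j < t)) →
    ∃[ h ] (Conn r h × ChangedEdge Tinit Tfin (ε (F h)) ×
      ∃[ m ] ∃[ js ] (m ≤ 2 * t ×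
        Run Tinit (ε (F h)) [] m (map F js) ×
        -- js lists the flips of C in a topological order of C
        Unique js ×
        (∀ j → (j ∈ js) ⇔ Conn r j) ×
        (∀ i j → Arc i j → i ∈ js → j ∈ js → OccursBefore i j js)))
theorem1 K n pt _ Tinit Tfin tri _ k F Ts (((refl , valid , _) , _) , normal) r t component-is-prefix =
  agent k F Ts (triangulation-good tri) valid r t component-is-prefix (proj₁ (normal r))
  where
  open Solution K n pt
  open TriangleProperties K n pt using (triangulation-good)
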